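{- Consider a class $\mathcal C$ of permutations that is closed under elementary reductions and extensions. Let $p(n,k)$ and $r(n,k)$ respectively be the number of all, respectively all reduced, permutations of $\{1,\ldots,n\}$ in the class having $k$ cycles. Then the generating functions $P(x,y):=\sum_{n,k}p(n,k)x^ny^k$ and $R(x,y):=\sum_{n,k}r(n,k)x^ny^k$ satisfy the equation $$P(x,y)=R\left(\frac{D(x,y)-1}{y},\,y\right)\cdot\frac{1}{\sqrt{(x+xy-1)^2-4x^2y}}.$$
   Context: A class of permutations is a set of permutations, each one a permutation of $\{1,\ldots,n\}$ for some $n$; the degenerate bijection of the empty set with itself is also considered a permutation. Let $\zeta_n=(1,2,\ldots,n)$; $i+1$ means $\zeta_n(i)$ (addition modulo $n$). Products are composed right to left, and fixed points count as cycles. An elementary reduction of the first kind: given $i$ with $\alpha(i)=i$, remove the cycle $(i)$ from the cycle decomposition of the permutation $\alpha$ of $\{1,\ldots,n\}$ and replace every $j>i$ by $j-1$, obtaining a permutation of $\{1,\ldots,n-1\}$. An elementary reduction of the second kind: given a dual fixed point $i$ of $\alpha$, i.e. $\alpha(i)=i+1$ (including $i=n$ with $\alpha(n)=1$), remove $i$ from the cycle containing it and replace every $j>i$ by $j-1$, obtaining a permutation of $\{1,\ldots,n-1\}$. Elementary extensions (of the first and second kind) are the inverses of these operations, assigning $\alpha$ to the resulting permutation $\alpha'$. A class is closed under elementary reductions and extensions if every result of applying such an operation to a member is again a member. A permutation $\alpha$ of $\{1,\ldots,n\}$ is reduced if neither $\alpha$ nor $\alpha^{ -1}\zeta_n$ has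 any fixed points, that is, if $\alpha$ has no fixed points and no dual fixed points. $D(x,y)=1+\sum_{n\ge1}\sum_{k=1}^n\frac1n\binom nk\binom n{k-1}x^ny^k$ is the generating function of noncrossing partitions (the coefficient of $x^ny^k$ is the number of noncrossing partitions of $\{1,\ldots,n\}$ with $k$ parts, with constant term $1$ by convention). The square root is the formal power series square root with constant term $1$.
   Formalization: The class is additionally assumed not to contain the empty permutation: for every closed class containing it the identity fails, since the coefficient of x y^0 is p(1,0)=0 on the left and r(0,0)=1 on the right. -}

module Defs where

open import Data.Fin.Base as Fin using (Fin; toℕ; fromℕ)
open import Data.Fin.Permutation
  using (Permutation′; _⟨$⟩ʳ_; _≈_; id; flip; _∘ₚ_; insert; remove; transpose)
import Data.Integer.Base as ℤ
open import Data.Nat.Base as ℕ using (ℕ; zero; suc; _∸_)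
open import Data.Nat.Combinatorics using (_C_)
open import Data.Product.Base using (Σ-syntax; _×_; proj₁)
open import Data.Rational.Base as ℚ using (ℚ; 0ℚ; 1ℚ)
open import Data.Rational.Properties using (+-0-commutativeMonoid)
open import Data.Sum.Base using (_⊎_)
open import Function.Bundles using (Bijection)
open import Level as Level using (Level; 0ℓ; _⊔_)
open import Relation.Binary.Bundles using (Setoid)
import Relation.Binary.Construct.Closure.Equivalence as EqClosure
import Relation.Binary.Construct.On as On
open import Relation.Binary.Definitions using (_Respects_)
open import Relation.Binary.PropositionalEquality
  using (_≡_; setoid; _→-setoid_)
open import Relation.Nullary.Negation using (¬_)

open import Algebra.Properties.CommutativeMonoid.Sum +-0-commutativeMonoid
  using (sum⁺-syntax)

private
  variable
    a b ℓ : Level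
    n : ℕ

------------------------------------------------------------------------
-- Permutations, with {1,…,n} represented by Fin n

-- The long cycle (1,2,…,n): the last element goes to the first, and every
-- other i to i + 1.
ζ : ∀ n → Permutation′ n
ζ zero    = id
ζ (suc n) = insert (fromℕ n) Fin.zero id

FixedPoint : Permutation′ n → Fin n → Set
FixedPoint α i = α ⟨$⟩ʳ i ≡ i

DualFixedPoint : Permutation′ n → Fin n → Set
DualFixedPoint {n} α i = α ⟨$⟩ʳ i ≡ ζ n ⟨$⟩ʳ i

-- _∘ₚ_ applies its left argument first, so ζ n ∘ₚ flip α is α⁻¹ζₙ.
Reduced : Permutation′ n → Set
Reduced {n} α =
  (∀ i → ¬ FixedPoint α i) × (∀ i → ¬ FixedPoint (ζ n ∘ₚ flip α) i)

-- Removes i from its cycle and relabels every j > i as j - 1.  Following α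
-- by the transposition of i and α(i) makes i a fixed point and sends the
-- predecessor of i to α(i).  If i was already fixed, the transposition is
-- the identity.
delete : Fin (suc n) → Permutation′ (suc n) → Permutation′ n
delete i α = remove i (α ∘ₚ transpose i (α ⟨$⟩ʳ i))

-- α ⟶ α′ when α′ is an elementary reduction of α, of the first or of the
-- second kind; equivalently, when α is an elementary extension of α′.
data _⟶_ : Permutation′ (suc n) → Permutation′ n → Set where
  first  : ∀ {α : Permutation′ (suc n)} {α′} i →
           FixedPoint α i → delete i α ≈ α′ → α ⟶ α′
  second : ∀ {α : Permutation′ (suc n)} {α′} i →
           DualFixedPoint α i → delete i α ≈ α′ → α ⟶ α′

-- Permutations are identified when they agree pointwise, since equality of
-- the underlying records is finer than equality of functions.
record PermutationClass ℓ : Set (Level.suc ℓ) where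
  field
    Member : ∀ {n} → Permutation′ n → Set ℓ
    resp   : ∀ {n} → Member {n} Respects _≈_

open PermutationClass public

ClosedUnderReductions : PermutationClass ℓ → Set ℓ
ClosedUnderReductions 𝒞 =
  ∀ {n} {α : Permutation′ (suc n)} {α′} → α ⟶ α′ → Member 𝒞 α → Member 𝒞 α′

ClosedUnderExtensions : PermutationClass ℓ → Set ℓ
ClosedUnderExtensions 𝒞 =
  ∀ {n} {α : Permutation′ (suc n)} {α′} → α ⟶ α′ → Member 𝒞 α′ → Member 𝒞 α

-- A closed class containing the empty permutation contains all noncrossing
-- permutations.  These are counted by D, whereas the reduced empty
-- permutation contributes the inverse square root itself to
-- R((D - 1)/y, y) / √…, so the generating function identity fails there:
-- the coefficients of xy⁰ are 0 and 1.
ExcludesEmpty : PermutationClass ℓ → Set ℓ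
ExcludesEmpty 𝒞 = ¬ Member 𝒞 {0} id

------------------------------------------------------------------------
-- Counting

HasCardinality : Setoid a b → ℕ → Set (a ⊔ b)
HasCardinality S m = Bijection (setoid (Fin m)) S

-- The cycles of α are the classes of the equivalence generated by
-- i ∼ α(i); fixed points give singleton classes.
cycles : Permutation′ n → Setoid 0ℓ 0ℓ
cycles α = EqClosure.setoid (λ i j → α ⟨$⟩ʳ i ≡ j)

HasCycles : Permutation′ n → ℕ → Set
HasCycles α k = HasCardinality (cycles α) k

permutationsWith : ∀ n → (Permutation′ n → Set ℓ) → Setoid ℓ 0ℓ
permutationsWith n Q =
  On.setoid {B = Σ[ α ∈ Permutation′ n ] Q α} (Fin n →-setoid Fin n)
    (λ x → proj₁ x ⟨$⟩ʳ_)

CountsAll : PermutationClass ℓ → (ℕ → ℕ → ℕ) → Set ℓ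
CountsAll 𝒞 p = ∀ n k →
  HasCardinality (permutationsWith n (λ α → Member 𝒞 α × HasCycles α k)) (p n k)

CountsReduced : PermutationClass ℓ → (ℕ → ℕ → ℕ) → Set ℓ
CountsReduced 𝒞 r = ∀ n k →
  HasCardinality
    (permutationsWith n (λ α → Member 𝒞 α × Reduced α × HasCycles α k)) (r n k)

------------------------------------------------------------------------
-- Formal power series in x and y over ℚ: A n k is the coefficient of xⁿyᵏ

Series : Set
Series = ℕ → ℕ → ℚ

infix  4 _≋_
infixl 6 _+_ _-_
infixl 7 _*_
infixr 8 _^_

_≋_ : Series → Series → Set
A ≋ B = ∀ n k → A n k ≡ B n k

fromℕℚ : ℕ → ℚ
fromℕℚ m = ℤ.+ m ℚ./ 1

generatingFunction : (ℕ → ℕ → ℕ) → Series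
generatingFunction c n k = fromℕℚ (c n k)

const : ℚ → Series
const q zero zero = q
const q _    _    = 0ℚ

𝟙 : Series
𝟙 = const 1ℚ

X : Series
X 1 0 = 1ℚ
X _ _ = 0ℚ

Y : Series
Y 0 1 = 1ℚ
Y _ _ = 0ℚ

_+_ : Series → Series → Series
(A + B) n k = A n k ℚ.+ B n k

_-_ : Series → Series → Series
(A - B) n k = A n k ℚ.- B n k

_*_ : Series → Series → Series
(A * B) n k =
  ∑[ i ≤ n ] ∑[ j ≤ k ] (A (toℕ i) (toℕ j) ℚ.* B (n ∸ toℕ i) (k ∸ toℕ j))

_^_ : Series → ℕ → Series
A ^ zero  = 𝟙
A ^ suc m = A * A ^ m

-- The quotient by y, for series all of whose terms are divisible by y.
divY : Series → Series
divY A n k = A n (suc k)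

-- The substitution A(B(x,y), y), for B divisible by x: then B ^ m has no
-- terms xⁿyᵏ with n < m, so only the powers m ≤ n contribute to xⁿyᵏ.
substX : Series → Series → Series
substX A B n k =
  ∑[ m ≤ n ] ∑[ j ≤ k ] (A (toℕ m) (toℕ j) ℚ.* (B ^ toℕ m) n (k ∸ toℕ j))

-- The condition k ≤ n is automatic, as n C k = 0 for k > n.
D : Series
D zero    zero    = 1ℚ
D zero    (suc k) = 0ℚ
D (suc n) zero    = 0ℚ
D (suc n) (suc k) =
  (ℤ.+ 1 ℚ./ suc n) ℚ.* fromℕℚ (suc n C suc k) ℚ.* fromℕℚ (suc n C k)

-- Over ℚ, a series with constant term 1 has exactly one square root in
-- this sense.
IsSquareRoot : Series → Series → Set
IsSquareRoot S A = S 0 0 ≡ 1ℚ × S * S ≋ A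

IsReciprocal : Series → Series → Set
IsReciprocal T S = T * S ≋ 𝟙

discriminant : Series
discriminant = (X + X * Y - 𝟙) ^ 2 - const (fromℕℚ 4) * X ^ 2 * Y

module Submission where

-- Let N(X) count the members of size n avoiding a set X of conditions of the
-- form "i is a fixed point" or "i is a dual fixed point".  These are 2n
-- conditions in a natural cyclic order, in which neighbours exclude each other.
-- Deleting i shows N(X) = N(X ∪ {c}) + N(X′) for a condition c ∉ X at i, with X′
-- a set of conditions in size n - 1.  Adding the conditions one by one in their
-- cyclic order leads from all members to the reduced ones, and solving the
-- resulting recurrences by reflection gives
--   p(n) = ∑ r(m) [wⁿ⁻ᵐ] φ(w)ⁿ,  where φ(w) = (1 + w)(1 + yw)
-- and p(n), r(m) are the polynomials in y enumerating by cycles.  On the other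
-- side, W = (D - 1)/y satisfies W = x φ(W), and 1 - x φ′(W) is the square root
-- in question.  By Lagrange inversion [xⁿ] Wᵐ/√… = [wⁿ⁻ᵐ] φ(w)ⁿ: as n grows,
-- both sides obey the same linear recurrences.  So do the polynomials
-- ∑ C(n,a) C(n,m+a) yᵃ, and this yields the Narayana numbers in D.

open import Algebra.Bundles using (CommutativeRing; Semiring)
import Algebra.Construct.Pointwise as Pointwise
import Algebra.Definitions.RawSemiring as RawSemiring
import Algebra.Properties.CommutativeMonoid.Sum as Sum
import Algebra.Properties.CommutativeSemigroup as CommutativeSemigroupProperties
import Algebra.Properties.Ring as RingProperties
import Algebra.Solver.Ring.NaturalCoefficients.Default as SemiringSolver
open import Algebra.Structures using (IsCommutativeRing)
open import Data.Fin.Base as Fin using (Fin; zero; suc; toℕ; fromℕ; punchIn; punchOut)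
open import Data.Fin.Permutation as Perm using (Permutation′; _⟨$⟩ʳ_; _⟨$⟩ˡ_; _∘ₚ_)
import Data.Fin.Permutation.Components as PC
import Data.Fin.Properties as Fin
import Data.Integer.Base as ℤ
import Data.Integer.Properties as ℤ
open import Data.Nat.Base as ℕ using (ℕ; zero; suc; pred; _∸_; _≤_; _<_; z≤n; s≤s)
import Data.Nat.Combinatorics as Combinatorics
import Data.Nat.Properties as ℕ
open import Data.Nat.Tactic.RingSolver using (solve-∀)
open import Data.Product.Base using (_×_; _,_; proj₁; proj₂; ∃)
open import Data.Rational.Base as ℚ using (ℚ; 0ℚ; 1ℚ; toℚᵘ)
import Data.Rational.Properties as ℚ
open import Data.Rational.Unnormalised.Base as ℚᵘ using (mkℚᵘ; *≡*)
import Data.Rational.Unnormalised.Properties as ℚᵘ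
open import Data.Sum.Base as Sum⊎ using (_⊎_; inj₁; inj₂)
open import Data.Unit.Base using (⊤; tt)
open import Function.Base using (_∘_; case_of_)
open import Function.Bundles using (Bijection)
open import Level using (Level)
open import Relation.Binary.Bundles using (Setoid)
import Relation.Binary.Construct.Closure.Equivalence as Eq
open import Relation.Binary.PropositionalEquality as ≡ using (_≡_; _≢_)
import Relation.Binary.Reasoning.Setoid as SetoidReasoning
open import Relation.Nullary using (¬_; Dec; yes; no; contradiction)
open import Relation.Nullary.Decidable using (¬?; _×-dec_; _→-dec_; map′)

-- In the order fixed 0, dual 0, fixed 1, dual 1, ... neighbouring conditions prescribe two values
-- at one point or one value at two points, hence exclude each other. A member satisfying c avoids
-- both neighbours of c automatically, and once its point is deleted the three become a single
-- condition of the smaller size, which X′ leaves free. So an arc of the cycle yields an arc again,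
-- and only arcs have to be counted. Two places break the uniform pattern. Starting from the empty
-- arc there is nothing to lose, which creates the boundary at which walks are reflected; this works
-- because φ(1/(yw)) = φ(w)/(yw²). And if all conditions but one are imposed, the deletion leads to
-- all but one in size n - 1, so the equations run around the seam between the last point and the
-- first; every two such deletions cost two points and one cycle, which sums to a geometric series
-- in yw². The two kinds of conditions differ only from size 2 on. Smaller members are absent, since
-- a permutation of size 1 reduces to the empty one.

-- Formal power series over a commutative ring

module PowerSeries {c ℓ} (R : CommutativeRing c ℓ) where

  private
    module R = CommutativeRing R
  open Sum R.+-commutativeMonoid using (sum⁺-syntax)
  open CommutativeSemigroupProperties R.+-commutativeSemigroup using (interchange; x∙yz≈y∙xz)
  open SetoidReasoning R.setoid

  PowerSeries : Set c
  PowerSeries = ℕ → R.Carrier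

  infix 4 _≐_
  _≐_ : PowerSeries → PowerSeries → Set ℓ
  A ≐ B = ∀ n → A n R.≈ B n

  infixl 6 _⊕_
  infixl 7 _⊛_

  _⊕_ : PowerSeries → PowerSeries → PowerSeries
  (A ⊕ B) n = A n R.+ B n

  constant : R.Carrier → PowerSeries
  constant a zero    = a
  constant a (suc n) = R.0#

  tail : PowerSeries → PowerSeries
  tail A n = A (suc n)

  -- Opaque, so that unification can read off the factors of a product.
  opaque

    _⊛_ : PowerSeries → PowerSeries → PowerSeries
    (A ⊛ B) n = ∑[ i ≤ n ] (A (toℕ i) R.* B (n ∸ toℕ i))

    ⊛-sum : ∀ A B n → (A ⊛ B) n R.≈ ∑[ i ≤ n ] (A (toℕ i) R.* B (n ∸ toℕ i))
    ⊛-sum A B n = R.refl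

    ⊛-zero : ∀ A B → (A ⊛ B) 0 R.≈ A 0 R.* B 0
    ⊛-zero A B = R.+-identityʳ _

    ⊛-cong≤ : ∀ n {A A′ B B′} →
              (∀ i → i ≤ n → A i R.≈ A′ i) → (∀ i → i ≤ n → B i R.≈ B′ i) →
              (A ⊛ B) n R.≈ (A′ ⊛ B′) n
    ⊛-cong≤ zero    a b = R.+-congʳ (R.*-cong (a 0 z≤n) (b 0 z≤n))
    ⊛-cong≤ (suc n) a b =
      R.+-cong (R.*-cong (a 0 z≤n) (b (suc n) ℕ.≤-refl))
               (⊛-cong≤ n (λ i i≤n → a (suc i) (s≤s i≤n)) (λ i i≤n → b i (ℕ.m≤n⇒m≤1+n i≤n)))

    ⊛-cong : ∀ {A A′ B B′} → A ≐ A′ → B ≐ B′ → A ⊛ B ≐ A′ ⊛ B′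
    ⊛-cong a b n = ⊛-cong≤ n (λ i _ → a i) (λ i _ → b i)

    -- The sum defining a product peels off the head of the left factor. This is the mirror image
    -- for the right factor, from which commutativity follows by induction.
    ⊛-sucʳ : ∀ A B n → (A ⊛ B) (suc n) R.≈ A (suc n) R.* B 0 R.+ (A ⊛ tail B) n
    ⊛-sucʳ A B zero    = x∙yz≈y∙xz _ _ _
    ⊛-sucʳ A B (suc n) =
      R.trans (R.+-congˡ (⊛-sucʳ (tail A) B n)) (x∙yz≈y∙xz _ _ _)

    ⊛-comm : ∀ A B → A ⊛ B ≐ B ⊛ A
    ⊛-comm A B zero    = R.+-congʳ (R.*-comm _ _)
    ⊛-comm A B (suc n) = begin
      A 0 R.* B (suc n) R.+ (tail A ⊛ B) n  ≈⟨ R.+-cong (R.*-comm _ _) (⊛-comm (tail A) B n) ⟩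
      B (suc n) R.* A 0 R.+ (B ⊛ tail A) n  ≈⟨ ⊛-sucʳ B A n ⟨
      (B ⊛ A) (suc n)                       ∎

    ⊛-distribʳ : ∀ A B C → (B ⊕ C) ⊛ A ≐ B ⊛ A ⊕ C ⊛ A
    ⊛-distribʳ A B C zero    = begin
      (B 0 R.+ C 0) R.* A 0 R.+ R.0#                     ≈⟨ R.+-cong (R.distribʳ _ _ _) (R.sym (R.+-identityʳ _)) ⟩
      (B 0 R.* A 0 R.+ C 0 R.* A 0) R.+ (R.0# R.+ R.0#)  ≈⟨ interchange _ _ _ _ ⟩
      _                                                  ∎
    ⊛-distribʳ A B C (suc n) = begin
      (B 0 R.+ C 0) R.* A (suc n) R.+ ((tail B ⊕ tail C) ⊛ A) n
        ≈⟨ R.+-cong (R.distribʳ _ _ _) (⊛-distribʳ A (tail B) (tail C) n) ⟩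
      (B 0 R.* A (suc n) R.+ C 0 R.* A (suc n)) R.+ ((tail B ⊛ A) n R.+ (tail C ⊛ A) n)
        ≈⟨ interchange _ _ _ _ ⟩
      _ ∎

    ⊛-scaleˡ : ∀ a B C n → ((λ i → a R.* B i) ⊛ C) n R.≈ a R.* (B ⊛ C) n
    ⊛-scaleˡ a B C zero    = begin
      a R.* B 0 R.* C 0 R.+ R.0#    ≈⟨ R.+-cong (R.*-assoc _ _ _) (R.sym (R.zeroʳ a)) ⟩
      a R.* (B 0 R.* C 0) R.+ a R.* R.0#  ≈⟨ R.distribˡ _ _ _ ⟨
      a R.* (B ⊛ C) 0               ∎
    ⊛-scaleˡ a B C (suc n) = begin
      a R.* B 0 R.* C (suc n) R.+ ((λ i → a R.* B (suc i)) ⊛ C) n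
        ≈⟨ R.+-cong (R.*-assoc _ _ _) (⊛-scaleˡ a (tail B) C n) ⟩
      a R.* (B 0 R.* C (suc n)) R.+ a R.* (tail B ⊛ C) n  ≈⟨ R.distribˡ _ _ _ ⟨
      a R.* (B ⊛ C) (suc n) ∎

    ⊛-assoc : ∀ A B C → (A ⊛ B) ⊛ C ≐ A ⊛ (B ⊛ C)
    ⊛-assoc A B C zero    = R.+-congʳ (begin
      (A ⊛ B) 0 R.* C 0        ≈⟨ R.*-congʳ (⊛-zero A B) ⟩
      A 0 R.* B 0 R.* C 0      ≈⟨ R.*-assoc _ _ _ ⟩
      A 0 R.* (B 0 R.* C 0)    ≈⟨ R.*-congˡ (⊛-zero B C) ⟨
      A 0 R.* (B ⊛ C) 0        ∎)
    ⊛-assoc A B C (suc n) = begin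
      -- By definition the tail of `A ⊛ B` is `A 0` times `tail B`, plus `tail A ⊛ B`; the induction
      -- hypothesis applies to the second summand.
      (A ⊛ B) 0 R.* C (suc n) R.+ (((λ i → A 0 R.* tail B i) ⊕ tail A ⊛ B) ⊛ C) n
        ≈⟨ R.+-cong (R.trans (R.*-congʳ (⊛-zero A B)) (R.*-assoc _ _ _)) (⊛-distribʳ C (λ i → A 0 R.* tail B i) (tail A ⊛ B) n) ⟩
      A 0 R.* (B 0 R.* C (suc n)) R.+
        (((λ i → A 0 R.* tail B i) ⊛ C) n R.+ ((tail A ⊛ B) ⊛ C) n)
        ≈⟨ R.+-congˡ (R.+-cong (⊛-scaleˡ _ (tail B) C n) (⊛-assoc (tail A) B C n)) ⟩
      A 0 R.* (B 0 R.* C (suc n)) R.+ (A 0 R.* (tail B ⊛ C) n R.+ (tail A ⊛ (B ⊛ C)) n)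
        ≈⟨ R.+-assoc _ _ _ ⟨
      A 0 R.* (B 0 R.* C (suc n)) R.+ A 0 R.* (tail B ⊛ C) n R.+ (tail A ⊛ (B ⊛ C)) n
        ≈⟨ R.+-congʳ (R.distribˡ _ _ _) ⟨
      (A ⊛ (B ⊛ C)) (suc n) ∎

    ⊛-zeroˡ : ∀ A → (λ _ → R.0#) ⊛ A ≐ λ _ → R.0#
    ⊛-zeroˡ A zero    = R.trans (R.+-identityʳ _) (R.zeroˡ _)
    ⊛-zeroˡ A (suc n) = begin
      R.0# R.* A (suc n) R.+ ((λ _ → R.0#) ⊛ A) n  ≈⟨ R.+-cong (R.zeroˡ _) (⊛-zeroˡ A n) ⟩
      R.0# R.+ R.0#                                ≈⟨ R.+-identityˡ _ ⟩
      R.0#                                         ∎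

    ⊛-constant : ∀ a A n → (constant a ⊛ A) n R.≈ a R.* A n
    ⊛-constant a A zero    = R.+-identityʳ _
    ⊛-constant a A (suc n) = R.trans (R.+-congˡ (⊛-zeroˡ A n)) (R.+-identityʳ _)

    ⊛-identityˡ : ∀ A → constant R.1# ⊛ A ≐ A
    ⊛-identityˡ A n = R.trans (⊛-constant R.1# A n) (R.*-identityˡ _)

  isCommutativeRing : IsCommutativeRing _≐_ _⊕_ _⊛_ (λ A n → R.- A n) (λ _ → R.0#) (constant R.1#)
  isCommutativeRing = record
    { isRing = record
      { +-isAbelianGroup = Pointwise.isAbelianGroup ℕ R.+-isAbelianGroup
      ; *-cong           = ⊛-cong
      ; *-assoc          = ⊛-assoc
      ; *-identity       = ⊛-identityˡ ,
          λ A n → R.trans (⊛-comm A (constant R.1#) n) (⊛-identityˡ A n)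
      ; distrib          =
          (λ A B C n → R.trans (⊛-comm A (B ⊕ C) n)
            (R.trans (⊛-distribʳ A B C n) (R.+-cong (⊛-comm B A n) (⊛-comm C A n)))) ,
          ⊛-distribʳ
      }
    ; *-comm = ⊛-comm
    }

  ring : CommutativeRing c ℓ
  ring = record { isCommutativeRing = isCommutativeRing }

  private
    module P = CommutativeRing ring

  opaque
    unfolding _⊛_

    -- The lowest coefficient of the product forces `A 0` to vanish, after which `tail A` is
    -- annihilated by `B` as well. Serves to cancel a sum of two square roots, whose constant term
    -- is 2.
    regular : ∀ B → (∀ a → a R.* B 0 R.≈ R.0# → a R.≈ R.0#) →
              ∀ A → A ⊛ B ≐ P.0# → A ≐ P.0#
    regular B reg A AB≈0 n = go n A AB≈0
      where
      go : ∀ n A → A ⊛ B ≐ P.0# → A n R.≈ R.0#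
      head≈0 : ∀ A → A ⊛ B ≐ P.0# → A 0 R.≈ R.0#
      head≈0 A e = reg (A 0) (R.trans (R.sym (⊛-zero A B)) (e 0))
      go zero    A e = head≈0 A e
      go (suc n) A e = go n (tail A) λ i → begin
        (tail A ⊛ B) i                              ≈⟨ R.+-identityˡ _ ⟨
        R.0# R.+ (tail A ⊛ B) i                     ≈⟨ R.+-congʳ (R.trans (R.*-congʳ (head≈0 A e)) (R.zeroˡ _)) ⟨
        A 0 R.* B (suc i) R.+ (tail A ⊛ B) i        ≈⟨ e (suc i) ⟩
        R.0#                                        ∎

  x : PowerSeries
  x (suc zero) = R.1#
  x _          = R.0#

  opaque
    unfolding _⊛_

    x-zero : ∀ A → (x ⊛ A) 0 R.≈ R.0#
    x-zero A = R.trans (R.+-identityʳ _) (R.zeroˡ _)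

    tail-x : tail x ≐ constant R.1#
    tail-x zero    = R.refl
    tail-x (suc n) = R.refl

    x-suc : ∀ A n → (x ⊛ A) (suc n) R.≈ A n
    x-suc A n = begin
      R.0# R.* A (suc n) R.+ (tail x ⊛ A) n  ≈⟨ R.+-cong (R.zeroˡ _) (⊛-cong {B = A} tail-x (λ _ → R.refl) n) ⟩
      R.0# R.+ (constant R.1# ⊛ A) n         ≈⟨ R.+-identityˡ _ ⟩
      (constant R.1# ⊛ A) n                  ≈⟨ ⊛-identityˡ A n ⟩
      A n                                    ∎

  Vanishes : ℕ → PowerSeries → Set ℓ
  Vanishes m A = ∀ i → i < m → A i R.≈ R.0#

  vanishes-x : ∀ {m A} → Vanishes m A → Vanishes (suc m) (x ⊛ A)
  vanishes-x {A = A} v zero    _         = x-zero A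
  vanishes-x {A = A} v (suc i) (s≤s i<m) = R.trans (x-suc A i) (v i i<m)

  vanishes-⊛ʳ : ∀ {m A} C → Vanishes m A → Vanishes m (A ⊛ C)
  vanishes-⊛ʳ {m} {A} C v i i<m = R.trans
    (⊛-cong≤ i {A′ = P.0#} {B = C} (λ j j≤i → v j (ℕ.≤-<-trans j≤i i<m)) (λ _ _ → R.refl))
    (P.zeroˡ C i)

  vanishes-weaken : ∀ {m n A} → m ≤ n → Vanishes n A → Vanishes m A
  vanishes-weaken m≤n v i i<m = v i (ℕ.<-≤-trans i<m m≤n)

  -- The iterates of a contraction for the x-adic metric stabilise.
  module FixedPoint (Φ : PowerSeries → PowerSeries)
    (contraction : ∀ n {A B} → (∀ i → i < n → A i R.≈ B i) → Φ A n R.≈ Φ B n)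
    where

    iterate : ℕ → PowerSeries
    iterate zero    = P.0#
    iterate (suc j) = Φ (iterate j)

    -- From the iterate with index `suc n` on, the coefficient at `n` no longer changes.
    fix : PowerSeries
    fix n = iterate (suc n) n

    stable : ∀ j n → n < j → iterate j n R.≈ iterate (suc j) n
    stable (suc j) n n<j = contraction n λ i i<n →
      stable j i (ℕ.<-≤-trans i<n (ℕ.≤-pred n<j))

    stable-+ : ∀ d j n → n < j → iterate j n R.≈ iterate (d ℕ.+ j) n
    stable-+ zero    j n n<j = R.refl
    stable-+ (suc d) j n n<j =
      R.trans (stable-+ d j n n<j) (stable (d ℕ.+ j) n (ℕ.<-≤-trans n<j (ℕ.m≤n+m j d)))

    fix-unfold : fix ≐ Φ fix
    fix-unfold n = contraction n λ i i<n →
      R.sym (R.trans (stable-+ (n ∸ suc i) (suc i) i ℕ.≤-refl)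
        (R.reflexive (≡.cong (λ m → iterate m i) (ℕ.m∸n+n≡m i<n))))

-- Identities for the equation w = x(1 + w)(1 + yw)

module QuadraticIdentities {c ℓ} (K : CommutativeRing c ℓ) where

  open CommutativeRing K
  open SemiringSolver commutativeSemiring
  open RingProperties ring using (-‿distribˡ-*; -‿involutive; +-cancelʳ)
  open SetoidReasoning setoid

  -- Subtraction is expanded here by hand, as the solver works over semirings. The other identities
  -- keep their terms on the sides where they are positive.
  [x-1]² : ∀ a → (a - 1#) * (a - 1#) + (a + a) ≈ a * a + 1#
  [x-1]² a = begin
    (a - 1#) * (a - 1#) + (a + a)          ≈⟨ +-cong (*-congˡ (+-comm _ _)) refl ⟩
    (a - 1#) * (- 1# + a) + (a + a)
      ≈⟨ solve 2 (λ a n → (a :+ n) :* (n :+ a) :+ (a :+ a) :=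
          a :* a :+ (n :* n) :+ (a :* (n :+ con 1)) :+ (a :* (n :+ con 1))) refl a (- 1#) ⟩
    a * a + (- 1#) * (- 1#) + a * (- 1# + 1#) + a * (- 1# + 1#)
      ≈⟨ +-cong (+-cong (+-congˡ -1*-1) lem) lem ⟩
    a * a + 1# + 0# + 0#                   ≈⟨ +-identityʳ _ ⟩
    a * a + 1# + 0#                        ≈⟨ +-identityʳ _ ⟩
    a * a + 1#                             ∎
    where
    lem : a * (- 1# + 1#) ≈ 0#
    lem = trans (*-congˡ (-‿inverseˡ 1#)) (zeroʳ a)
    -1*-1 : (- 1#) * (- 1#) ≈ 1#
    -1*-1 = trans (sym (-‿distribˡ-* 1# (- 1#))) (trans (-‿cong (*-identityˡ _)) (-‿involutive 1#))

  module _ (x y w : Carrier) (w-eqn : w ≈ x * ((1# + w) * (1# + y * w))) where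

    -- The equation of `w` multiplied by `g`. For g = wᵐt its coefficients give the recurrence
    -- `stepₘ` of `Lagrangian`.
    w-step : ∀ g → w * g ≈ x * (g + (w * g + y * (w * g)) + y * (w * (w * g)))
    w-step g = begin
      w * g                                  ≈⟨ *-congʳ w-eqn ⟩
      x * ((1# + w) * (1# + y * w)) * g
        ≈⟨ solve 4 (λ x y w g → x :* ((con 1 :+ w) :* (con 1 :+ y :* w)) :* g :=
             x :* (g :+ (w :* g :+ y :* (w :* g)) :+ y :* (w :* (w :* g)))) refl x y w g ⟩
      _ ∎

  module _ (x y w s : Carrier)
    (w-eqn : w ≈ x * ((1# + w) * (1# + y * w)))
    (s-eqn : s + (x + x * y + (x * y * w + x * y * w)) ≈ 1#)
    where

    -- With s = 1 - xφ′(w), multiplying by w and inserting w = xφ(w) cancels all terms linear in w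
    -- except sw.
    s*w : s * w + x * y * (w * w) ≈ x
    s*w = +-cancelʳ (x * w + x * y * w + x * y * (w * w)) _ _ (begin
      s * w + x * y * (w * w) + (x * w + x * y * w + x * y * (w * w))
        ≈⟨ solve 4 (λ x y w s → s :* w :+ x :* y :* (w :* w) :+ (x :* w :+ x :* y :* w :+ x :* y :* (w :* w)) :=
             (s :+ (x :+ x :* y :+ (x :* y :* w :+ x :* y :* w))) :* w) refl x y w s ⟩
      (s + (x + x * y + (x * y * w + x * y * w))) * w  ≈⟨ *-congʳ s-eqn ⟩
      1# * w                                           ≈⟨ *-identityˡ w ⟩
      w                                                ≈⟨ w-eqn ⟩
      x * ((1# + w) * (1# + y * w))
        ≈⟨ solve 3 (λ x y w → x :* ((con 1 :+ w) :* (con 1 :+ y :* w)) :=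
             x :+ (x :* w :+ x :* y :* w :+ x :* y :* (w :* w))) refl x y w ⟩
      x + (x * w + x * y * w + x * y * (w * w)) ∎)

    -- The right-hand side minus 4x²y is the discriminant of xyw² + (x + xy - 1)w + x = 0, and s is
    -- up to sign the derivative 2xyw + x + xy - 1 of this quadratic at its root w.
    s²-eqn : s * s + (x * x * y + x * x * y + x * x * y + x * x * y) ≈
             (x + x * y - 1#) * (x + x * y - 1#)
    s²-eqn = +-cancelʳ (x + x * y + (x + x * y)) _ _ (begin
      s * s + (x * x * y + x * x * y + x * x * y + x * x * y) + (b + b)
        ≈⟨ +-cong (+-congˡ (solve 3 (λ x y z → x :* z :* y :+ x :* z :* y :+ x :* z :* y :+ x :* z :* y := con 4 :* (x :* y :* z)) refl x y x)) refl ⟩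
      s * s + four * (x * y * x) + (b + b)
        ≈⟨ +-cong (+-congˡ (*-congˡ (*-congˡ s*w))) (+-cong (*-identityʳ b) (*-identityʳ b)) ⟨
      -- The first two summands form (s + 2xyw)². As s + 2xyw = 1 - b, the factors 1 written as the
      -- left-hand side of `s-eqn` turn the claim into an identity without subtraction.
      s * s + four * (x * y * (s * w + x * y * (w * w))) + (b * 1# + b * 1#)
        ≈⟨ +-congˡ (+-cong (*-congˡ s-eqn) (*-congˡ s-eqn)) ⟨
      s * s + four * (x * y * (s * w + x * y * (w * w))) +
        (b * (s + (b + (x * y * w + x * y * w))) + b * (s + (b + (x * y * w + x * y * w))))
        ≈⟨ solve 4 (λ x y w s → let b = x :+ x :* y ; e = s :+ (b :+ (x :* y :* w :+ x :* y :* w)) in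
             s :* s :+ con 4 :* (x :* y :* (s :* w :+ x :* y :* (w :* w))) :+ (b :* e :+ b :* e) :=
             b :* b :+ e :* e) refl x y w s ⟩
      b * b + (s + (b + (x * y * w + x * y * w))) * (s + (b + (x * y * w + x * y * w)))
        ≈⟨ +-congˡ (trans (*-cong s-eqn s-eqn) (*-identityˡ 1#)) ⟩
      b * b + 1#
        ≈⟨ [x-1]² b ⟨
      (b - 1#) * (b - 1#) + (b + b) ∎)
      where
      b = x + x * y
      four = 1# + 1# + 1# + 1#

    module _ (t : Carrier) (t-eqn : t * s ≈ 1#) where

      t-step : t ≈ 1# + x * (t + y * t + (y * (w * t) + y * (w * t)))
      t-step = begin
        t                                                        ≈⟨ *-identityʳ t ⟨
        t * 1#                                                   ≈⟨ *-congˡ s-eqn ⟨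
        t * (s + (x + x * y + (x * y * w + x * y * w)))
          ≈⟨ solve 5 (λ x y w s t → t :* (s :+ (x :+ x :* y :+ (x :* y :* w :+ x :* y :* w))) :=
               t :* s :+ x :* (t :+ y :* t :+ (y :* (w :* t) :+ y :* (w :* t)))) refl x y w s t ⟩
        t * s + x * (t + y * t + (y * (w * t) + y * (w * t)))    ≈⟨ +-congʳ t-eqn ⟩
        1# + x * (t + y * t + (y * (w * t) + y * (w * t)))       ∎

      -- This is `s*w` multiplied by t. It recovers w from the series wᵐt, whose coefficients are
      -- products of binomials, and so makes the Narayana numbers accessible.
      w-from-t : w + x * (y * (w * (w * t))) ≈ x * t
      w-from-t = begin
        w + x * (y * (w * (w * t)))           ≈⟨ +-congʳ (*-identityˡ w) ⟨
        1# * w + x * (y * (w * (w * t)))      ≈⟨ +-congʳ (*-congʳ t-eqn) ⟨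
        t * s * w + x * (y * (w * (w * t)))
          ≈⟨ solve 5 (λ x y w s t → t :* s :* w :+ x :* (y :* (w :* (w :* t))) :=
               (s :* w :+ x :* y :* (w :* w)) :* t) refl x y w s t ⟩
        (s * w + x * y * (w * w)) * t         ≈⟨ *-congʳ s*w ⟩
        x * t                                 ∎

  module _ (x y : Carrier) where

    φ : Carrier
    φ = (1# + x) * (1# + y * x)

    φ-step : ∀ p → φ * p ≈ p + x * (p + y * p + y * (x * p))
    φ-step p = solve 3 (λ x y p → (con 1 :+ x) :* (con 1 :+ y :* x) :* p :=
      p :+ x :* (p :+ y :* p :+ y :* (x :* p))) refl x y p

    xφ-step : ∀ m p → x * m * (φ * p) ≈
      x * (m * p + (x * m * p + y * (x * m * p)) + y * (x * (x * m) * p))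
    xφ-step m p = solve 4 (λ x y m p →
      x :* m :* ((con 1 :+ x) :* (con 1 :+ y :* x) :* p) :=
      x :* (m :* p :+ (x :* m :* p :+ y :* (x :* m :* p)) :+ y :* (x :* (x :* m) :* p)))
      refl x y m p

    -- The factors of φ: `P` accounts for fixed points, which carry a cycle, and `Q` for dual ones.
    -- Reflection at the boundary costs a power of q = yx².
    P Q q : Carrier
    P = 1# + y * x
    Q = 1# + x
    q = x * (x * y)

    -- One identity for each of the three recurrences of AvoidanceRecurrences,
    -- where h stands for Z φ^d and g for q^u.
    fix-first : ∀ h →
      h * Q + x * (y * h) + q * 1# * (h * (Q * P)) ≈
      h * (Q * P) + x * (q * 1# * (h * P)) + x * (y * (q * 1# * h))
    fix-first h = solve 3 (λ x y h →
      let P = con 1 :+ y :* x ; Q = con 1 :+ x ; q = x :* (x :* y) :* con 1 in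
      h :* Q :+ x :* (y :* h) :+ q :* (h :* (Q :* P)) :=
      h :* (Q :* P) :+ x :* (q :* (h :* P)) :+ x :* (y :* (q :* h))) refl x y h

    fix-next : ∀ h g →
      h * Q + x * (y * (h * Q)) + q * (q * g) * (h * (Q * P)) ≈
      h * (Q * P) + x * (q * (q * g) * (h * P)) + x * (y * (x * (q * g * (h * P))))
    fix-next h g = solve 4 (λ x y h g →
      let P = con 1 :+ y :* x ; Q = con 1 :+ x ; q = x :* (x :* y) in
      h :* Q :+ x :* (y :* (h :* Q)) :+ q :* (q :* g) :* (h :* (Q :* P)) :=
      h :* (Q :* P) :+ x :* (q :* (q :* g) :* (h :* P)) :+ x :* (y :* (x :* (q :* g :* (h :* P)))))
      refl x y h g

    dual-next : ∀ h g →
      h * Q + q * (q * g) * h + x * (q * g * h) ≈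
      h + x * h + x * (q * g * (h * P))
    dual-next h g = solve 4 (λ x y h g →
      let P = con 1 :+ y :* x ; Q = con 1 :+ x ; q = x :* (x :* y) in
      h :* Q :+ q :* (q :* g) :* h :+ x :* (q :* g :* h) :=
      h :+ x :* h :+ x :* (q :* g :* (h :* P))) refl x y h g

  four*x²*y : ∀ x y → (1# + 1# + 1# + 1#) * (x * (x * 1#)) * y ≈
              x * x * y + x * x * y + x * x * y + x * x * y
  four*x²*y x y = solve 2 (λ x y → con 4 :* (x :* (x :* con 1)) :* y :=
    x :* x :* y :+ x :* x :* y :+ x :* x :* y :+ x :* x :* y) refl x y

  [a-b]+b : ∀ a b → a - b + b ≈ a
  [a-b]+b a b = trans (+-assoc a (- b) b) (trans (+-congˡ (-‿inverseˡ b)) (+-identityʳ a))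

  difference-of-squares : ∀ a b → a * a ≈ b * b → (a - b) * (a + b) ≈ 0#
  difference-of-squares a b a²≈b² = +-cancelʳ (b * b) _ _ (begin
    (a - b) * (a + b) + b * b
      ≈⟨ solve 3 (λ a b n → (a :+ n) :* (a :+ b) :+ b :* b := a :* a :+ (n :+ b) :* a :+ (n :+ b) :* b) refl a b (- b) ⟩
    a * a + (- b + b) * a + (- b + b) * b
      ≈⟨ +-cong (+-congˡ (trans (*-congʳ (-‿inverseˡ b)) (zeroˡ a))) (trans (*-congʳ (-‿inverseˡ b)) (zeroˡ b)) ⟩
    a * a + 0# + 0#    ≈⟨ trans (+-identityʳ _) (+-identityʳ _) ⟩
    a * a              ≈⟨ a²≈b² ⟩
    b * b              ≈⟨ +-identityˡ _ ⟨
    0# + b * b         ∎)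

-- Lagrange inversion for φ(w) = (1 + w)(1 + yw)

module LagrangeInversion {c ℓ} (B : CommutativeRing c ℓ) (y : CommutativeRing.Carrier B) where

  open PowerSeries B
  private
    module B = CommutativeRing B
    module K = CommutativeRing ring
  open B using (_≈_; _+_; _*_; 0#; 1#)
  open RawSemiring (Semiring.rawSemiring K.semiring) public using (_^_)
  open RawSemiring (Semiring.rawSemiring B.semiring) using () renaming (_^_ to _^ᴮ_)
  open SemiringSolver B.commutativeSemiring
  open SetoidReasoning B.setoid

  -- For the coefficient of wⁿ⁻ᵐ in φⁿ, the steps express multiplication by φ = 1 + (1 + y)w + yw².
  -- At m = 0 the neighbour m = -1 is y times the one at m = 1, by the symmetry of φ, whence the
  -- doubled term.
  record Lagrangian (V : ℕ → ℕ → B.Carrier) : Set ℓ where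
    field
      V₀₀   : V 0 0 ≈ 1#
      Vₘ₀   : ∀ m → V (suc m) 0 ≈ 0#
      step₀ : ∀ n → V 0 (suc n) ≈ V 0 n + y * V 0 n + (y * V 1 n + y * V 1 n)
      stepₘ : ∀ m n → V (suc m) (suc n) ≈
              V m n + (V (suc m) n + y * V (suc m) n) + y * V (suc (suc m)) n

  Lagrangian-unique : ∀ {U V} → Lagrangian U → Lagrangian V → ∀ m n → U m n ≈ V m n
  Lagrangian-unique {U} {V} u v = go
    where
    module U = Lagrangian u
    module V = Lagrangian v
    go : ∀ m n → U m n ≈ V m n
    go zero    zero    = B.trans U.V₀₀ (B.sym V.V₀₀)
    go (suc m) zero    = B.trans (U.Vₘ₀ m) (B.sym (V.Vₘ₀ m))
    go zero    (suc n) = B.trans (U.step₀ n) (B.trans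
      (B.+-cong (B.+-cong (go 0 n) (B.*-congˡ (go 0 n)))
                (B.+-cong (B.*-congˡ (go 1 n)) (B.*-congˡ (go 1 n))))
      (B.sym (V.step₀ n)))
    go (suc m) (suc n) = B.trans (U.stepₘ m n) (B.trans
      (B.+-cong (B.+-cong (go m n) (B.+-cong (go (suc m) n) (B.*-congˡ (go (suc m) n))))
                (B.*-congˡ (go (suc (suc m)) n)))
      (B.sym (V.stepₘ m n)))

  Y : PowerSeries
  Y = constant y

  Y-* : ∀ A n → (Y ⊛ A) n ≈ y * A n
  Y-* = ⊛-constant y

  module ViaW (w s t : PowerSeries)
    (w-eqn : w ≐ x ⊛ ((K.1# ⊕ w) ⊛ (K.1# ⊕ Y ⊛ w)))
    (s-eqn : s ⊕ (x ⊕ x ⊛ Y ⊕ (x ⊛ Y ⊛ w ⊕ x ⊛ Y ⊛ w)) ≐ K.1#)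
    (t-eqn : t ⊛ s ≐ K.1#)
    where

    G : ℕ → PowerSeries
    G m = w ^ m ⊛ t

    G₀ : G 0 ≐ t
    G₀ = K.*-identityˡ t

    Gₛ : ∀ m → G (suc m) ≐ w ⊛ G m
    Gₛ m = K.*-assoc w (w ^ m) t

    lagrangian : Lagrangian G
    lagrangian = record
      { V₀₀   = begin
          G 0 0   ≈⟨ G₀ 0 ⟩
          t 0     ≈⟨ QuadraticIdentities.t-step ring x Y w s w-eqn s-eqn t t-eqn 0 ⟩
          1# + _  ≈⟨ B.+-congˡ (x-zero _) ⟩
          1# + 0# ≈⟨ B.+-identityʳ _ ⟩
          1#      ∎
      ; Vₘ₀   = λ m → begin
          G (suc m) 0    ≈⟨ Gₛ m 0 ⟩
          (w ⊛ G m) 0    ≈⟨ QuadraticIdentities.w-step ring x Y w w-eqn (G m) 0 ⟩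
          (x ⊛ _) 0      ≈⟨ x-zero _ ⟩
          0#             ∎
      ; step₀ = λ n → begin
          G 0 (suc n)   ≈⟨ G₀ (suc n) ⟩
          t (suc n)     ≈⟨ QuadraticIdentities.t-step ring x Y w s w-eqn s-eqn t t-eqn (suc n) ⟩
          0# + (x ⊛ (t ⊕ Y ⊛ t ⊕ (Y ⊛ (w ⊛ t) ⊕ Y ⊛ (w ⊛ t)))) (suc n)
            ≈⟨ B.trans (B.+-identityˡ _) (x-suc (t ⊕ Y ⊛ t ⊕ (Y ⊛ (w ⊛ t) ⊕ Y ⊛ (w ⊛ t))) n) ⟩
          t n + (Y ⊛ t) n + ((Y ⊛ (w ⊛ t)) n + (Y ⊛ (w ⊛ t)) n)
            ≈⟨ B.+-cong (B.+-congˡ (Y-* t n)) (B.+-cong (Y-* (w ⊛ t) n) (Y-* (w ⊛ t) n)) ⟩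
          t n + y * t n + (y * (w ⊛ t) n + y * (w ⊛ t) n)
            ≈⟨ B.+-cong (B.+-cong (G₀ n) (B.*-congˡ (G₀ n)))
                 (B.+-cong (B.*-congˡ (G₁ n)) (B.*-congˡ (G₁ n))) ⟨
          _ ∎
      ; stepₘ = λ m n → begin
          G (suc m) (suc n)   ≈⟨ Gₛ m (suc n) ⟩
          (w ⊛ G m) (suc n)   ≈⟨ QuadraticIdentities.w-step ring x Y w w-eqn (G m) (suc n) ⟩
          (x ⊛ (G m ⊕ (w ⊛ G m ⊕ Y ⊛ (w ⊛ G m)) ⊕ Y ⊛ (w ⊛ (w ⊛ G m)))) (suc n)
            ≈⟨ x-suc (G m ⊕ (w ⊛ G m ⊕ Y ⊛ (w ⊛ G m)) ⊕ Y ⊛ (w ⊛ (w ⊛ G m))) n ⟩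
          G m n + ((w ⊛ G m) n + (Y ⊛ (w ⊛ G m)) n) + (Y ⊛ (w ⊛ (w ⊛ G m))) n
            ≈⟨ B.+-cong (B.+-congˡ (B.+-congˡ (Y-* (w ⊛ G m) n))) (Y-* (w ⊛ (w ⊛ G m)) n) ⟩
          G m n + ((w ⊛ G m) n + y * (w ⊛ G m) n) + y * (w ⊛ (w ⊛ G m)) n
            ≈⟨ B.+-cong (B.+-congˡ (B.+-cong (Gₛ m n) (B.*-congˡ (Gₛ m n)))) (B.*-congˡ (G₂ m n)) ⟨
          _ ∎
      }
      where
      G₁ : G 1 ≐ w ⊛ t
      G₁ = K.trans (Gₛ 0) (K.*-congˡ {w} G₀)
      G₂ : ∀ m → G (suc (suc m)) ≐ w ⊛ (w ⊛ G m)
      G₂ m = K.trans (Gₛ (suc m)) (K.*-congˡ {w} (Gₛ m))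

    w₀≈0 : w 0 ≈ 0#
    w₀≈0 = B.trans (w-eqn 0) (x-zero _)

    wₛ-eqn : ∀ n → w (suc n) + y * G 2 n ≈ G 0 n
    wₛ-eqn n = begin
      w (suc n) + y * G 2 n
        ≈⟨ B.+-congˡ (B.trans (B.*-congˡ (K.trans (Gₛ 1) (K.*-congˡ {w} (K.trans (Gₛ 0) (K.*-congˡ {w} G₀))) n)) (B.sym (Y-* (w ⊛ (w ⊛ t)) n))) ⟩
      w (suc n) + (Y ⊛ (w ⊛ (w ⊛ t))) n          ≈⟨ B.+-congˡ (x-suc (Y ⊛ (w ⊛ (w ⊛ t))) n) ⟨
      w (suc n) + (x ⊛ (Y ⊛ (w ⊛ (w ⊛ t)))) (suc n)  ≈⟨ QuadraticIdentities.w-from-t ring x Y w s w-eqn s-eqn t t-eqn (suc n) ⟩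
      (x ⊛ t) (suc n)                            ≈⟨ x-suc t n ⟩
      t n                                        ≈⟨ G₀ n ⟨
      G 0 n                                      ∎

  φ : PowerSeries
  φ = QuadraticIdentities.φ ring x Y

  -- The coefficient of xⁿ⁻ᵐ in φⁿ, read as 0 for m > n; shifting by xᵐ avoids truncated
  -- subtraction.
  Φ : ℕ → ℕ → B.Carrier
  Φ m n = (x ^ m ⊛ φ ^ n) n

  private
    φₛ : ∀ p n → (φ ⊛ p) (suc n) ≈ p (suc n) + (p n + y * p n + y * (x ⊛ p) n)
    φₛ p n = begin
      (φ ⊛ p) (suc n)   ≈⟨ QuadraticIdentities.φ-step ring x Y p (suc n) ⟩
      p (suc n) + (x ⊛ (p ⊕ Y ⊛ p ⊕ Y ⊛ (x ⊛ p))) (suc n)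
        ≈⟨ B.+-congˡ (x-suc (p ⊕ Y ⊛ p ⊕ Y ⊛ (x ⊛ p)) n) ⟩
      p (suc n) + (p n + (Y ⊛ p) n + (Y ⊛ (x ⊛ p)) n)
        ≈⟨ B.+-congˡ (B.+-cong (B.+-congˡ (Y-* p n)) (Y-* (x ⊛ p) n)) ⟩
      _ ∎

    x*-0 : ∀ A C → (x ⊛ A ⊛ C) 0 ≈ 0#
    x*-0 A C = B.trans (K.*-assoc x A C 0) (x-zero _)

    Φ-step : ∀ m n → Φ (suc m) (suc n) ≈
              Φ m n + (Φ (suc m) n + y * Φ (suc m) n) + y * Φ (suc (suc m)) n
    Φ-step m n = begin
      (x ⊛ x ^ m ⊛ (φ ⊛ φ ^ n)) (suc n)   ≈⟨ QuadraticIdentities.xφ-step ring x Y (x ^ m) (φ ^ n) (suc n) ⟩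
      (x ⊛ (p₀ ⊕ (p₁ ⊕ Y ⊛ p₁) ⊕ Y ⊛ p₂)) (suc n)   ≈⟨ x-suc (p₀ ⊕ (p₁ ⊕ Y ⊛ p₁) ⊕ Y ⊛ p₂) n ⟩
      p₀ n + (p₁ n + (Y ⊛ p₁) n) + (Y ⊛ p₂) n        ≈⟨ B.+-cong (B.+-congˡ (B.+-congˡ (Y-* p₁ n))) (Y-* p₂ n) ⟩
      _ ∎
      where
      p₀ = x ^ m ⊛ φ ^ n
      p₁ = x ⊛ x ^ m ⊛ φ ^ n
      p₂ = x ⊛ (x ⊛ x ^ m) ⊛ φ ^ n

    -- The symmetry yw²φ(1/(yw)) = φ(w) compares the coefficients of φⁿ at n + i and n - i. Instead
    -- of substituting 1/(yw), the induction multiplies by one more factor φ and compares with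
    -- `Φ-step`.
    φ^-palindromic : ∀ n i → (φ ^ n) (i ℕ.+ n) ≈ y ^ᴮ i * Φ i n
    φ^-palindromic n       zero    = B.sym (B.trans (B.*-identityˡ _) (K.*-identityˡ (φ ^ n) n))
    φ^-palindromic zero    (suc i) = B.sym (B.trans (B.*-congˡ (x*-0 (x ^ i) K.1#)) (B.zeroʳ _))
    φ^-palindromic (suc n) (suc i) = begin
      (φ ⊛ p) (suc i ℕ.+ suc n)
        ≡⟨ ≡.cong (λ j → (φ ⊛ p) (suc j)) (ℕ.+-suc i n) ⟩
      (φ ⊛ p) (suc (suc (i ℕ.+ n)))
        ≈⟨ φₛ p (suc (i ℕ.+ n)) ⟩
      p (suc (suc (i ℕ.+ n))) + (p (suc (i ℕ.+ n)) + y * p (suc (i ℕ.+ n)) + y * (x ⊛ p) (suc (i ℕ.+ n)))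
        ≈⟨ B.+-cong (φ^-palindromic n (suc (suc i)))
             (B.+-cong (B.+-cong (φ^-palindromic n (suc i)) (B.*-congˡ (φ^-palindromic n (suc i))))
                       (B.*-congˡ (B.trans (x-suc p (i ℕ.+ n)) (φ^-palindromic n i)))) ⟩
      y * (y * e) * Φ (suc (suc i)) n + (y * e * Φ (suc i) n + y * (y * e * Φ (suc i) n) + y * (e * Φ i n))
        ≈⟨ solve 5 (λ y e a b c → y :* (y :* e) :* c :+ (y :* e :* b :+ y :* (y :* e :* b) :+ y :* (e :* a)) :=
             y :* e :* (a :+ (b :+ y :* b) :+ y :* c)) B.refl y e (Φ i n) (Φ (suc i) n) (Φ (suc (suc i)) n) ⟩
      y * e * (Φ i n + (Φ (suc i) n + y * Φ (suc i) n) + y * Φ (suc (suc i)) n)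
        ≈⟨ B.*-congˡ (Φ-step i n) ⟨
      y * e * Φ (suc i) (suc n) ∎
      where
      p = φ ^ n
      e = y ^ᴮ i

  Φ-lagrangian : Lagrangian Φ
  Φ-lagrangian = record
    { V₀₀   = K.*-identityˡ K.1# 0
    ; Vₘ₀   = λ m → x*-0 (x ^ m) K.1#
    ; step₀ = λ n → let p = φ ^ n in begin
        (K.1# ⊛ (φ ⊛ p)) (suc n)    ≈⟨ K.*-identityˡ (φ ⊛ p) (suc n) ⟩
        (φ ⊛ p) (suc n)             ≈⟨ φₛ p n ⟩
        p (suc n) + (p n + y * p n + y * (x ⊛ p) n)
          -- The coefficient just beyond the middle of φⁿ is replaced by its mirror image, a second
          -- copy of `y * Φ 1 n`.
          ≈⟨ B.+-cong (φ^-palindromic n 1) (B.+-cong (B.+-cong (Φ₀ n) (B.*-congˡ (Φ₀ n))) (B.*-congˡ (Φ₁ n))) ⟩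
        y * 1# * Φ 1 n + (Φ 0 n + y * Φ 0 n + y * Φ 1 n)
          ≈⟨ solve 3 (λ y a b → y :* con 1 :* b :+ (a :+ y :* a :+ y :* b) := a :+ y :* a :+ (y :* b :+ y :* b))
               B.refl y (Φ 0 n) (Φ 1 n) ⟩
        Φ 0 n + y * Φ 0 n + (y * Φ 1 n + y * Φ 1 n) ∎
    ; stepₘ = Φ-step
    }
    where
    Φ₀ : ∀ n → (φ ^ n) n ≈ Φ 0 n
    Φ₀ n = B.sym (K.*-identityˡ (φ ^ n) n)
    Φ₁ : ∀ n → (x ⊛ φ ^ n) n ≈ Φ 1 n
    Φ₁ n = K.*-congʳ {φ ^ n} (K.sym (K.*-identityʳ x)) n

  x^-* : ∀ m n A → (x ^ m ⊛ A) (m ℕ.+ n) ≈ A n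
  x^-* zero    n A = K.*-identityˡ A n
  x^-* (suc m) n A = B.trans (K.*-assoc x (x ^ m) A (suc m ℕ.+ n))
    (B.trans (x-suc (x ^ m ⊛ A) (m ℕ.+ n)) (x^-* m n A))

  φ^-coefficient : ∀ m n → m ≤ n → (φ ^ n) (n ∸ m) ≈ Φ m n
  φ^-coefficient m n m≤n = begin
    (φ ^ n) (n ∸ m)              ≈⟨ x^-* m (n ∸ m) (φ ^ n) ⟨
    (x ^ m ⊛ φ ^ n) (m ℕ.+ (n ∸ m))  ≡⟨ ≡.cong (x ^ m ⊛ φ ^ n) (ℕ.m+[n∸m]≡n m≤n) ⟩
    Φ m n ∎

-- Solving the recurrences by reflection

module AvoidanceRecurrences {c ℓ} (B : CommutativeRing c ℓ) (y : CommutativeRing.Carrier B) where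

  open PowerSeries B
  open LagrangeInversion B y
  private
    module B = CommutativeRing B
    module K = CommutativeRing ring
  open B using (_≈_; _+_; _*_; 0#; 1#)
  open Sum B.+-commutativeMonoid using (sum⁺-syntax; sum-cong-≋)
  open QuadraticIdentities ring using (fix-first; fix-next; dual-next)
  open SemiringSolver B.commutativeSemiring
  open SetoidReasoning B.setoid

  xY-suc : ∀ A n → (x ⊛ (Y ⊛ A)) (suc n) ≈ y * A n
  xY-suc A n = B.trans (x-suc (Y ⊛ A) n) (Y-* A n)

  private
    cancel : ∀ {a b} e → a + e ≈ b + e → a ≈ b
    cancel {a} {b} e = RingProperties.+-cancelʳ B.ring e a b

  -- E u d and F u d enumerate the members of sizes u + d and u + d + 1 that
  -- avoid all conditions at the first u indices; F u d also excludes that the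
  -- next index is a fixed point.
  module _ (E F : ℕ → ℕ → B.Carrier) (r : ℕ → B.Carrier)
    (r₀≈0   : r 0 ≈ 0#)
    (r₁≈0   : r 1 ≈ 0#)
    (E₀₀≈0  : E 0 0 ≈ 0#)
    (E-zero : ∀ d → E 0 (suc d) ≈ F 0 d + y * E 0 d)
    (E-suc  : ∀ u d → E (suc u) (suc d) ≈ F (suc u) d + y * F u d)
    (F-suc  : ∀ u d → F u (suc d) ≈ E (suc u) (suc d) + E u (suc d))
    (F₀₀≈0  : F 0 0 ≈ 0#)
    (F₁₀    : F 1 0 ≈ r 2)
    (F-last : ∀ u → F (suc (suc u)) 0 ≈
                    r (suc (suc (suc u))) + (r (suc (suc u)) + y * F u 0))
    where

    private
      P Q q : PowerSeries
      P = QuadraticIdentities.P ring x Y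
      Q = QuadraticIdentities.Q ring x Y
      q = QuadraticIdentities.q ring x Y

    -- Z = r/(1 - yw²), with one factor yw² for each passage around the seam: by `F-last`, two
    -- deletions there remove two points and one cycle.
    Z : PowerSeries
    Z zero          = r 0
    Z (suc zero)    = r 1
    Z (suc (suc n)) = r (suc (suc n)) + y * Z n

    private
      q-assoc : ∀ A → q ⊛ A ≐ x ⊛ (x ⊛ (Y ⊛ A))
      q-assoc A = K.trans (K.*-assoc x (x ⊛ Y) A) (K.*-congˡ {x} (K.*-assoc x Y A))

      Z-eqn : Z ≐ r ⊕ q ⊛ Z
      Z-eqn n = B.trans (lemma n) (B.+-congˡ (B.sym (q-assoc Z n)))
        where
        lemma : Z ≐ r ⊕ x ⊛ (x ⊛ (Y ⊛ Z))
        lemma zero          = B.sym (B.trans (B.+-congˡ (x-zero _)) (B.+-identityʳ _))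
        lemma (suc zero)    = B.sym (B.trans
          (B.+-congˡ (B.trans (x-suc (x ⊛ (Y ⊛ Z)) 0) (x-zero _))) (B.+-identityʳ _))
        lemma (suc (suc n)) = B.+-congˡ (B.sym (B.trans (x-suc (x ⊛ (Y ⊛ Z)) (suc n)) (xY-suc Z n)))

      vanishes-q : ∀ {m A} → Vanishes m A → Vanishes (suc m) (q ⊛ A)
      vanishes-q {m} {A} v i i<m+1 = B.trans (q-assoc A i)
        (vanishes-x (vanishes-weaken (ℕ.n≤1+n m) (vanishes-x λ j j<m →
          B.trans (Y-* A j) (B.trans (B.*-congˡ (v j j<m)) (B.zeroʳ y)))) i i<m+1)

      vanishes-q^ : ∀ u → Vanishes u (q ^ u)
      vanishes-q^ zero    i ()
      vanishes-q^ (suc u) = vanishes-q (vanishes-q^ u)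

      ZQ : ∀ n → (Z ⊛ Q) (suc n) ≈ Z (suc n) + Z n
      ZQ n = begin
        (Z ⊛ Q) (suc n)                    ≈⟨ K.distribˡ Z K.1# x (suc n) ⟩
        (Z ⊛ K.1#) (suc n) + (Z ⊛ x) (suc n)
          ≈⟨ B.+-cong (K.*-identityʳ Z (suc n)) (B.trans (K.*-comm Z x (suc n)) (x-suc Z n)) ⟩
        Z (suc n) + Z n                    ∎

      -- The recursion of `F-last` goes down by two, as does that of `Z`, so both parities need a
      -- start; the vanishing of r in sizes 0 and 1 supplies it.
      F-Z : ∀ u → F u 0 ≈ Z (suc u) + Z u
      F-Z zero          = B.trans F₀₀≈0 (B.sym (B.trans (B.+-cong r₁≈0 r₀≈0) (B.+-identityʳ 0#)))
      F-Z (suc zero)    = B.trans F₁₀ (B.sym (begin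
        r 2 + y * r 0 + r 1   ≈⟨ B.+-cong (B.+-congˡ (B.trans (B.*-congˡ r₀≈0) (B.zeroʳ y))) r₁≈0 ⟩
        r 2 + 0# + 0#         ≈⟨ B.trans (B.+-identityʳ _) (B.+-identityʳ _) ⟩
        r 2                   ∎))
      F-Z (suc (suc u)) = begin
        F (suc (suc u)) 0                      ≈⟨ F-last u ⟩
        r₃ + (r₂ + y * F u 0)                  ≈⟨ B.+-congˡ (B.+-congˡ (B.*-congˡ (F-Z u))) ⟩
        r₃ + (r₂ + y * (Z (suc u) + Z u))      ≈⟨ B.+-congˡ (B.+-congˡ (B.distribˡ y _ _)) ⟩
        r₃ + (r₂ + (y * Z (suc u) + y * Z u))  ≈⟨ B.+-congˡ (x∙yz≈y∙xz r₂ _ _) ⟩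
        r₃ + (y * Z (suc u) + (r₂ + y * Z u))  ≈⟨ B.+-assoc _ _ _ ⟨
        r₃ + y * Z (suc u) + (r₂ + y * Z u)    ∎
        where
        open CommutativeSemigroupProperties B.+-commutativeSemigroup using (x∙yz≈y∙xz)
        r₂ = r (suc (suc u))
        r₃ = r (suc (suc (suc u)))

      -- The recurrences describe walks.  H d and H d Q enumerate all walks, and
      -- the terms with q^(u+1) in E-eqn and F-eqn come from reflecting those that
      -- cross the boundary.
      H : ℕ → PowerSeries
      H d = Z ⊛ φ ^ d

      H-suc : ∀ d → H (suc d) ≐ H d ⊛ (Q ⊛ P)
      H-suc d = K.trans (K.*-congˡ {Z} (K.*-comm φ (φ ^ d))) (K.sym (K.*-assoc Z (φ ^ d) φ))

    E-eqn : ℕ → ℕ → Set ℓ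
    E-eqn u d = E u d + (q ⊛ q ^ u ⊛ H d) (u ℕ.+ d) ≈ H d (u ℕ.+ d)

    -- Replacing w by 1/(yw) turns 1 + w into (1 + yw)/(yw), so the reflected term has `P` where the
    -- direct one has `Q`.
    F-eqn : ℕ → ℕ → Set ℓ
    F-eqn u d = F u d + (x ⊛ (q ⊛ q ^ u ⊛ (H d ⊛ P))) (suc (u ℕ.+ d)) ≈
                (H d ⊛ Q) (suc (u ℕ.+ d))

    private
      qᵘ : ℕ → PowerSeries
      qᵘ u = q ⊛ q ^ u

      q-H-suc : ∀ u d → qᵘ u ⊛ H (suc d) ≐ qᵘ u ⊛ (H d ⊛ (Q ⊛ P))
      q-H-suc u d = K.*-congˡ {qᵘ u} (H-suc d)

      E-eqn₀₀ : E-eqn 0 0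
      E-eqn₀₀ = B.trans
        (B.+-cong E₀₀≈0 (vanishes-⊛ʳ (H 0) (vanishes-q^ 1) 0 (s≤s z≤n)))
        (B.trans (B.+-identityʳ 0#) (B.sym (B.trans (K.*-identityʳ Z 0) r₀≈0)))

      -- The uniform pattern would ask for a term F at u = -1; the recurrence has `E 0 d` in its
      -- place. That the reflected terms make up for this is `fix-first`.
      E-eqn-zero : ∀ d → F-eqn 0 d → E-eqn 0 d → E-eqn 0 (suc d)
      E-eqn-zero d f e = cancel (s₁ + y * s₀) (begin
        E 0 (suc d) + (qᵘ 0 ⊛ H (suc d)) n + (s₁ + y * s₀)
          ≈⟨ B.+-congʳ (B.+-cong (E-zero d) (q-H-suc 0 d n)) ⟩
        F 0 d + y * E 0 d + t + (s₁ + y * s₀)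
          ≈⟨ solve 6 (λ f y e t s₁ s₀ → f :+ y :* e :+ t :+ (s₁ :+ y :* s₀) :=
               f :+ s₁ :+ y :* (e :+ s₀) :+ t) B.refl (F 0 d) y (E 0 d) t s₁ s₀ ⟩
        (F 0 d + s₁) + y * (E 0 d + s₀) + t
          ≈⟨ B.+-congʳ (B.+-cong f (B.trans (B.*-congˡ e) (B.sym (xY-suc h d)))) ⟩
        (h ⊛ Q) n + (x ⊛ (Y ⊛ h)) n + t
          ≈⟨ fix-first x Y h n ⟩
        (h ⊛ (Q ⊛ P)) n + s₁ + (x ⊛ (Y ⊛ (qᵘ 0 ⊛ h))) n
          ≈⟨ B.+-cong (B.+-congʳ (B.sym (H-suc d n))) (xY-suc (qᵘ 0 ⊛ h) d) ⟩
        H (suc d) n + s₁ + y * s₀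
          ≈⟨ B.+-assoc _ _ _ ⟩
        H (suc d) n + (s₁ + y * s₀) ∎)
        where
        n = suc d
        h = H d
        t = (qᵘ 0 ⊛ (h ⊛ (Q ⊛ P))) n
        s₀ = (qᵘ 0 ⊛ h) d
        s₁ = (x ⊛ (qᵘ 0 ⊛ (h ⊛ P))) n

      E-eqn-suc : ∀ u d → F-eqn (suc u) d → F-eqn u d → E-eqn (suc u) (suc d)
      E-eqn-suc u d f₁ f₀ = ≡.subst
        (λ n → E (suc u) (suc d) + (qᵘ (suc u) ⊛ H (suc d)) n ≈ H (suc d) n)
        (≡.cong suc (≡.sym (ℕ.+-suc u d)))
        (cancel (s₁ + y * s₀) (begin
        E (suc u) (suc d) + (qᵘ (suc u) ⊛ H (suc d)) n + (s₁ + y * s₀)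
          ≈⟨ B.+-congʳ (B.+-cong (E-suc u d) (q-H-suc (suc u) d n)) ⟩
        F (suc u) d + y * F u d + t + (s₁ + y * s₀)
          ≈⟨ solve 6 (λ f y e t s₁ s₀ → f :+ y :* e :+ t :+ (s₁ :+ y :* s₀) :=
               f :+ s₁ :+ y :* (e :+ s₀) :+ t) B.refl (F (suc u) d) y (F u d) t s₁ s₀ ⟩
        (F (suc u) d + s₁) + y * (F u d + s₀) + t
          ≈⟨ B.+-congʳ (B.+-cong f₁ (B.trans (B.*-congˡ f₀) (B.sym (xY-suc (h ⊛ Q) (suc (u ℕ.+ d)))))) ⟩
        (h ⊛ Q) n + (x ⊛ (Y ⊛ (h ⊛ Q))) n + t
          ≈⟨ fix-next x Y h (q ^ u) n ⟩
        (h ⊛ (Q ⊛ P)) n + s₁ + (x ⊛ (Y ⊛ (x ⊛ (qᵘ u ⊛ (h ⊛ P))))) n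
          ≈⟨ B.+-cong (B.+-congʳ (B.sym (H-suc d n))) (xY-suc (x ⊛ (qᵘ u ⊛ (h ⊛ P))) (suc (u ℕ.+ d))) ⟩
        H (suc d) n + s₁ + y * s₀
          ≈⟨ B.+-assoc _ _ _ ⟩
        H (suc d) n + (s₁ + y * s₀) ∎))
        where
        n = suc (suc (u ℕ.+ d))
        h = H d
        t = (qᵘ (suc u) ⊛ (h ⊛ (Q ⊛ P))) n
        s₀ = (x ⊛ (qᵘ u ⊛ (h ⊛ P))) (suc (u ℕ.+ d))
        s₁ = (x ⊛ (qᵘ (suc u) ⊛ (h ⊛ P))) n

      F-eqn-zero : ∀ u → F-eqn u 0
      F-eqn-zero u = begin
        F u 0 + (x ⊛ (qᵘ u ⊛ (H 0 ⊛ P))) (suc (u ℕ.+ 0))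
          ≡⟨ ≡.cong (λ n → F u 0 + (x ⊛ (qᵘ u ⊛ (H 0 ⊛ P))) (suc n)) (ℕ.+-identityʳ u) ⟩
        F u 0 + (x ⊛ (qᵘ u ⊛ (H 0 ⊛ P))) (suc u)
          -- The reflected term has order at least u + 2: with no step taken, no walk has crossed
          -- the boundary.
          ≈⟨ B.+-congˡ (vanishes-x (vanishes-⊛ʳ (H 0 ⊛ P) (vanishes-q^ (suc u))) (suc u) ℕ.≤-refl) ⟩
        F u 0 + 0#                      ≈⟨ B.+-identityʳ _ ⟩
        F u 0                           ≈⟨ F-Z u ⟩
        Z (suc u) + Z u                 ≈⟨ ZQ u ⟨
        (Z ⊛ Q) (suc u)                 ≈⟨ K.*-congʳ {Q} (K.*-identityʳ Z) (suc u) ⟨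
        (H 0 ⊛ Q) (suc u)               ≡⟨ ≡.cong (λ n → (H 0 ⊛ Q) (suc n)) (ℕ.+-identityʳ u) ⟨
        (H 0 ⊛ Q) (suc (u ℕ.+ 0))       ∎

      F-eqn-suc : ∀ u d → E-eqn (suc u) (suc d) → E-eqn u (suc d) → F-eqn u (suc d)
      F-eqn-suc u d e₁ e₀ = cancel (s₁ + s₀) (begin
        F u (suc d) + t + (s₁ + s₀)
          ≈⟨ B.+-congʳ (B.+-congʳ (F-suc u d)) ⟩
        E (suc u) (suc d) + E u (suc d) + t + (s₁ + s₀)
          ≈⟨ solve 5 (λ a b t s₁ s₀ → a :+ b :+ t :+ (s₁ :+ s₀) := a :+ s₁ :+ (b :+ s₀) :+ t)
               B.refl (E (suc u) (suc d)) (E u (suc d)) t s₁ s₀ ⟩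
        (E (suc u) (suc d) + s₁) + (E u (suc d) + s₀) + t
          ≈⟨ B.+-congʳ (B.+-cong e₁ (B.trans e₀ (B.sym (x-suc h (u ℕ.+ suc d))))) ⟩
        h n + (x ⊛ h) n + t
          ≈⟨ dual-next x Y h (q ^ u) n ⟨
        (h ⊛ Q) n + s₁ + (x ⊛ (qᵘ u ⊛ h)) n
          ≈⟨ B.trans (B.+-congˡ (x-suc (qᵘ u ⊛ h) (u ℕ.+ suc d))) (B.+-assoc _ _ _) ⟩
        (h ⊛ Q) n + (s₁ + s₀) ∎)
        where
        n = suc (u ℕ.+ suc d)
        h = H (suc d)
        t = (x ⊛ (qᵘ u ⊛ (h ⊛ P))) n
        s₁ = (qᵘ (suc u) ⊛ h) n
        s₀ = (qᵘ u ⊛ h) (u ℕ.+ suc d)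

      -- E lags behind F by one step: at d = 0 all conditions are imposed, and E then enumerates
      -- reduced members, by r and not by `Z`. Only the corner `E-eqn₀₀` is available there.
      E-F-eqns : ∀ d → (∀ u → E-eqn u (suc d)) × (∀ u → F-eqn u d)
      E-F-eqns zero    = e , F-eqn-zero
        where
        e : ∀ u → E-eqn u 1
        e zero    = E-eqn-zero 0 (F-eqn-zero 0) E-eqn₀₀
        e (suc u) = E-eqn-suc u 0 (F-eqn-zero (suc u)) (F-eqn-zero u)
      E-F-eqns (suc d) = e , f
        where
        f : ∀ u → F-eqn u (suc d)
        f u = F-eqn-suc u d (proj₁ (E-F-eqns d) (suc u)) (proj₁ (E-F-eqns d) u)
        e : ∀ u → E-eqn u (suc (suc d))
        e zero    = E-eqn-zero (suc d) (f 0) (proj₁ (E-F-eqns d) 0)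
        e (suc u) = E-eqn-suc u (suc d) (f (suc u)) (f u)

      E-eqn₀ : ∀ n → E-eqn 0 n
      E-eqn₀ zero    = E-eqn₀₀
      E-eqn₀ (suc n) = proj₁ (E-F-eqns n) 0

    -- At u = 0 the reflected term is qZφⁿ, and Z - qZ = r undoes the geometric series.
    E-formula : ∀ n → E 0 n ≈ ∑[ m ≤ n ] (r (toℕ m) * Φ (toℕ m) n)
    E-formula n = B.trans (cancel _ (begin
      E 0 n + (qᵘ 0 ⊛ H n) n            ≈⟨ E-eqn₀ n ⟩
      (Z ⊛ φ ^ n) n                     ≈⟨ K.*-congʳ {φ ^ n} Z-eqn n ⟩
      ((r ⊕ q ⊛ Z) ⊛ φ ^ n) n           ≈⟨ K.distribʳ (φ ^ n) r (q ⊛ Z) n ⟩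
      (r ⊛ φ ^ n) n + (q ⊛ Z ⊛ φ ^ n) n
        ≈⟨ B.+-congˡ (B.trans (K.*-assoc q Z (φ ^ n) n) (K.*-congʳ {H n} (K.sym (K.*-identityʳ q)) n)) ⟩
      (r ⊛ φ ^ n) n + (qᵘ 0 ⊛ H n) n    ∎)) (begin
      (r ⊛ φ ^ n) n                                           ≈⟨ ⊛-sum r (φ ^ n) n ⟩
      ∑[ m ≤ n ] (r (toℕ m) * (φ ^ n) (n ∸ toℕ m))
        ≈⟨ sum-cong-≋ {suc n} (λ m → B.*-congˡ {r (toℕ m)} (φ^-coefficient (toℕ m) n (Fin.toℕ≤pred[n] m))) ⟩
      ∑[ m ≤ n ] (r (toℕ m) * Φ (toℕ m) n)                    ∎)

-- The series W and substitution into a power series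

module Substitution {c ℓ} (B : CommutativeRing c ℓ) (y : CommutativeRing.Carrier B) where

  open PowerSeries B
  open LagrangeInversion B y
  private
    module B = CommutativeRing B
    module K = CommutativeRing ring
  open B using (_≈_; _+_; _*_; 0#; 1#)
  open Sum B.+-commutativeMonoid using (sum; sum⁺-syntax; sum-cong-≋; sum-replicate-zero)
  open SetoidReasoning B.setoid

  private
    F : PowerSeries → PowerSeries
    F A = x ⊛ ((K.1# ⊕ A) ⊛ (K.1# ⊕ Y ⊛ A))

    -- The leading factor x makes each coefficient of `F A` depend on earlier coefficients of `A`
    -- only.
    contraction : ∀ n {A C} → (∀ i → i < n → A i ≈ C i) → F A n ≈ F C n
    contraction zero    A≈C = B.trans (x-zero _) (B.sym (x-zero _))
    contraction (suc n) A≈C = B.trans (x-suc _ n) (B.trans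
      (⊛-cong≤ n (λ i i≤n → B.+-congˡ (A≈C i (s≤s i≤n)))
        (λ i i≤n → B.+-congˡ (B.trans (Y-* _ i) (B.trans (B.*-congˡ (A≈C i (s≤s i≤n))) (B.sym (Y-* _ i))))))
      (B.sym (x-suc _ n)))

  open FixedPoint F contraction public using () renaming (fix to W; fix-unfold to W-eqn)

  vanishes-W^ : ∀ m → Vanishes m (W ^ m)
  vanishes-W^ zero    i ()
  vanishes-W^ (suc m) i i<1+m = B.trans (K.*-congʳ {W ^ m} W-eqn i) (B.trans
    (K.*-assoc x _ (W ^ m) i)
    (vanishes-x (λ j j<m → B.trans (K.*-comm _ (W ^ m) j) (vanishes-⊛ʳ _ (vanishes-W^ m) j j<m)) i i<1+m))

  ∑-⊛ : ∀ {N} (f : Fin N → PowerSeries) A n →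
        ((λ i → sum (λ m → f m i)) ⊛ A) n ≈ sum (λ m → (f m ⊛ A) n)
  ∑-⊛ {zero}  f A n = K.zeroˡ A n
  ∑-⊛ {suc N} f A n = B.trans (K.distribʳ A (f Fin.zero) (λ i → sum (λ m → f (Fin.suc m) i)) n)
    (B.+-congˡ (∑-⊛ (f ∘ Fin.suc) A n))

  ∑-truncate : ∀ {i N} (g : ℕ → B.Carrier) → i ≤ N → (∀ m → i < m → g m ≈ 0#) →
               ∑[ m ≤ i ] g (toℕ m) ≈ ∑[ m ≤ N ] g (toℕ m)
  ∑-truncate {N = N} g z≤n g≈0 = B.+-congˡ (B.sym (B.trans
    (sum-cong-≋ {N} (λ m → g≈0 (suc (toℕ m)) (s≤s z≤n))) (sum-replicate-zero N)))
  ∑-truncate g (s≤s i≤N) g≈0 = B.+-congˡ (∑-truncate (g ∘ suc) i≤N (λ m i<m → g≈0 (suc m) (s≤s i<m)))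

  substitute : (ℕ → B.Carrier) → PowerSeries
  substitute r n = ∑[ m ≤ n ] (r (toℕ m) * (W ^ toℕ m) n)

  -- The range of the sum in `substitute` grows with the degree. As Wᵐ has order at least m, all
  -- these sums may be taken up to n, and a sum with fixed range passes through the product.
  substitute-⊛ : ∀ r t n → (substitute r ⊛ t) n ≈ ∑[ m ≤ n ] (r (toℕ m) * (W ^ toℕ m ⊛ t) n)
  substitute-⊛ r t n = begin
    (substitute r ⊛ t) n
      ≈⟨ ⊛-cong≤ n (λ i i≤n → ∑-truncate (λ m → r m * (W ^ m) i) i≤n
           (λ m i<m → B.trans (B.*-congˡ (vanishes-W^ m i i<m)) (B.zeroʳ (r m)))) (λ _ _ → B.refl) ⟩
    ((λ i → ∑[ m ≤ n ] (r (toℕ m) * (W ^ toℕ m) i)) ⊛ t) n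
      ≈⟨ ∑-⊛ {suc n} (λ m i → r (toℕ m) * (W ^ toℕ m) i) t n ⟩
    ∑[ m ≤ n ] (((λ i → r (toℕ m) * (W ^ toℕ m) i) ⊛ t) n)
      ≈⟨ sum-cong-≋ {suc n} (λ m → ⊛-scaleˡ (r (toℕ m)) (W ^ toℕ m) t n) ⟩
    ∑[ m ≤ n ] (r (toℕ m) * (W ^ toℕ m ⊛ t) n) ∎

-- Binomial identities and natural numbers in ℚ

module Binomials where

  open import Defs using (fromℕℚ)
  open Combinatorics using (_C_; nCk+nC[k+1]≡[n+1]C[k+1])
  open import Data.Nat.Base using (_+_; _*_)
  open ≡

  pascal : ∀ n k → suc n C suc k ≡ n C k + n C suc k
  pascal n k = sym (nCk+nC[k+1]≡[n+1]C[k+1] n k)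

  absorption : ∀ n k → suc k * (suc n C suc k) ≡ suc n * (n C k)
  absorption zero    zero    = refl
  absorption zero    (suc k) = ℕ.*-zeroʳ k
  absorption (suc n) zero    = begin
    suc (suc n) C 1 + 0             ≡⟨ cong (_+ 0) (pascal (suc n) 0) ⟩
    1 + suc n C 1 + 0               ≡⟨ cong (1 +_) (absorption n 0) ⟩
    suc (suc n) * 1                 ∎
    where open ≡-Reasoning
  absorption (suc n) (suc k) = begin
    suc (suc k) * (suc (suc n) C suc (suc k))
      ≡⟨ cong (suc (suc k) *_) (pascal (suc n) (suc k)) ⟩
    suc (suc k) * (a + suc n C suc (suc k))
      ≡⟨ ℕ.*-distribˡ-+ (suc (suc k)) a _ ⟩
    a + suc k * a + suc (suc k) * (suc n C suc (suc k))
      ≡⟨ cong₂ (λ u v → a + u + v) (absorption n k) (absorption n (suc k)) ⟩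
    a + suc n * (n C k) + suc n * (n C suc k)
      ≡⟨ ℕ.+-assoc a _ _ ⟩
    a + (suc n * (n C k) + suc n * (n C suc k))
      ≡⟨ cong (a +_) (ℕ.*-distribˡ-+ (suc n) (n C k) _) ⟨
    a + suc n * (n C k + n C suc k)
      ≡⟨ cong (λ c → a + suc n * c) (pascal n k) ⟨
    a + suc n * a ∎
    where
    open ≡-Reasoning
    a = suc n C suc k

  -- Narayana numbers as 2 × 2 determinants of binomials, C(n,b+1)² - C(n,b)C(n,b+2). Pascal's rule
  -- leaves three entries of row n, tied together by two instances of `absorption`.
  narayana : ∀ n b → suc n * ((n C suc b) * (n C suc b)) ≡
             (suc n C suc (suc b)) * (suc n C suc b) + suc n * ((n C b) * (n C suc (suc b)))
  narayana n b rewrite pascal n (suc b) | pascal n b =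
    identity (n C b) (n C suc b) (n C suc (suc b))
      (trans (cong (suc b *_) (sym (pascal n b))) (absorption n b))
      (trans (cong (suc (suc b) *_) (sym (pascal n (suc b)))) (absorption n (suc b)))
    where
    identity : ∀ c₀ c₁ c₂ → suc b * (c₀ + c₁) ≡ suc n * c₀ → suc (suc b) * (c₁ + c₂) ≡ suc n * c₁ →
               suc n * (c₁ * c₁) ≡ (c₁ + c₂) * (c₀ + c₁) + suc n * (c₀ * c₂)
    -- The term added to both sides is the surplus that arises when the two relations are used
    -- without subtraction.
    identity c₀ c₁ c₂ e₁ e₂ = ℕ.+-cancelʳ-≡ (suc b * c₀ * c₁) _ _ (begin
      suc n * (c₁ * c₁) + suc b * c₀ * c₁
        ≡⟨ cong (_+ suc b * c₀ * c₁) (trans (sym (ℕ.*-assoc (suc n) c₁ c₁)) (cong (_* c₁) (sym e₂))) ⟩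
      suc (suc b) * (c₁ + c₂) * c₁ + suc b * c₀ * c₁
        ≡⟨ regroup₁ b c₀ c₁ c₂ ⟩
      c₁ * (c₁ + c₂) + suc b * c₁ * c₂ + suc b * (c₀ + c₁) * c₁
        ≡⟨ cong (c₁ * (c₁ + c₂) + suc b * c₁ * c₂ +_) (trans (cong (_* c₁) e₁) (regroup₂ (suc n) c₀ c₁)) ⟩
      c₁ * (c₁ + c₂) + suc b * c₁ * c₂ + c₀ * (suc n * c₁)
        ≡⟨ cong (λ u → c₁ * (c₁ + c₂) + suc b * c₁ * c₂ + c₀ * u) e₂ ⟨
      c₁ * (c₁ + c₂) + suc b * c₁ * c₂ + c₀ * (suc (suc b) * (c₁ + c₂))
        ≡⟨ regroup₃ b c₀ c₁ c₂ ⟩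
      (c₁ + c₂) * (c₀ + c₁) + suc b * (c₀ + c₁) * c₂ + suc b * c₀ * c₁
        ≡⟨ cong (λ u → (c₁ + c₂) * (c₀ + c₁) + u + suc b * c₀ * c₁)
             (trans (cong (_* c₂) e₁) (ℕ.*-assoc (suc n) c₀ c₂)) ⟩
      (c₁ + c₂) * (c₀ + c₁) + suc n * (c₀ * c₂) + suc b * c₀ * c₁ ∎)
      where
      open ≡-Reasoning
      regroup₁ : ∀ b c₀ c₁ c₂ → suc (suc b) * (c₁ + c₂) * c₁ + suc b * c₀ * c₁ ≡
                 c₁ * (c₁ + c₂) + suc b * c₁ * c₂ + suc b * (c₀ + c₁) * c₁
      regroup₁ = solve-∀
      regroup₂ : ∀ n c₀ c₁ → n * c₀ * c₁ ≡ c₀ * (n * c₁)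
      regroup₂ = solve-∀
      regroup₃ : ∀ b c₀ c₁ c₂ → c₁ * (c₁ + c₂) + suc b * c₁ * c₂ + c₀ * (suc (suc b) * (c₁ + c₂)) ≡
                 (c₁ + c₂) * (c₀ + c₁) + suc b * (c₀ + c₁) * c₂ + suc b * c₀ * c₁
      regroup₃ = solve-∀

  private
    toℚᵘ-/ : ∀ i n → toℚᵘ (i ℚ./ suc n) ℚᵘ.≃ mkℚᵘ i n
    toℚᵘ-/ i n = ℚ.toℚᵘ-fromℚᵘ (mkℚᵘ i n)

  -- Opaque, as unfolding it on open terms sets off the gcd computations of ℚ._/_.
  opaque

    ι : ℕ → ℚ
    ι = fromℕℚ

    fromℕℚ≡ι : ∀ n → fromℕℚ n ≡ ι n
    fromℕℚ≡ι n = refl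

    ι-zero : ι 0 ≡ 0ℚ
    ι-zero = refl

    ι-one : ι 1 ≡ 1ℚ
    ι-one = refl

    ι-+ : ∀ m n → ι (m + n) ≡ ι m ℚ.+ ι n
    ι-+ m n = ℚ.toℚᵘ-injective (begin
      toℚᵘ (ι (m + n))                    ≈⟨ toℚᵘ-/ (ℤ.+ (m + n)) 0 ⟩
      mkℚᵘ (ℤ.+ (m + n)) 0
        ≈⟨ *≡* (cong (ℤ._* ℤ.+ 1) (cong₂ ℤ._+_ (sym (ℤ.*-identityʳ (ℤ.+ m))) (sym (ℤ.*-identityʳ (ℤ.+ n))))) ⟩
      mkℚᵘ (ℤ.+ m) 0 ℚᵘ.+ mkℚᵘ (ℤ.+ n) 0       ≈⟨ ℚᵘ.+-cong (toℚᵘ-/ (ℤ.+ m) 0) (toℚᵘ-/ (ℤ.+ n) 0) ⟨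
      toℚᵘ (ι m) ℚᵘ.+ toℚᵘ (ι n)     ≈⟨ ℚ.toℚᵘ-homo-+ (ι m) (ι n) ⟨
      toℚᵘ (ι m ℚ.+ ι n)             ∎)
      where open ℚᵘ.≃-Reasoning

    ι-* : ∀ m n → ι (m * n) ≡ ι m ℚ.* ι n
    ι-* m n = ℚ.toℚᵘ-injective (begin
      toℚᵘ (ι (m * n))                    ≈⟨ toℚᵘ-/ (ℤ.+ (m * n)) 0 ⟩
      mkℚᵘ (ℤ.+ (m * n)) 0                     ≈⟨ *≡* (cong (ℤ._* ℤ.+ 1) (ℤ.pos-* m n)) ⟩
      mkℚᵘ (ℤ.+ m) 0 ℚᵘ.* mkℚᵘ (ℤ.+ n) 0       ≈⟨ ℚᵘ.*-cong (toℚᵘ-/ (ℤ.+ m) 0) (toℚᵘ-/ (ℤ.+ n) 0) ⟨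
      toℚᵘ (ι m) ℚᵘ.* toℚᵘ (ι n)     ≈⟨ ℚ.toℚᵘ-homo-* (ι m) (ι n) ⟨
      toℚᵘ (ι m ℚ.* ι n)             ∎)
      where open ℚᵘ.≃-Reasoning

    1/n*n : ∀ n → (ℤ.+ 1 ℚ./ suc n) ℚ.* ι (suc n) ≡ 1ℚ
    1/n*n n = ℚ.toℚᵘ-injective (begin
      toℚᵘ ((ℤ.+ 1 ℚ./ suc n) ℚ.* ι (suc n))        ≈⟨ ℚ.toℚᵘ-homo-* (ℤ.+ 1 ℚ./ suc n) (ι (suc n)) ⟩
      toℚᵘ (ℤ.+ 1 ℚ./ suc n) ℚᵘ.* toℚᵘ (ι (suc n))  ≈⟨ ℚᵘ.*-cong (toℚᵘ-/ (ℤ.+ 1) n) (toℚᵘ-/ (ℤ.+ suc n) 0) ⟩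
      mkℚᵘ (ℤ.+ 1) n ℚᵘ.* mkℚᵘ (ℤ.+ suc n) 0             ≈⟨ *≡* (trans (ℤ.*-identityʳ _) (trans (ℤ.*-identityˡ (ℤ.+ suc n))
        (trans (cong ℤ.+_ (sym (ℕ.*-identityʳ (suc n)))) (sym (ℤ.*-identityˡ _))))) ⟩
      toℚᵘ 1ℚ                                            ∎)
      where open ℚᵘ.≃-Reasoning

-- Deleting and inserting a point, and the effect on cycles

module PointInsertion where

  open import Defs using (ζ; delete; HasCardinality; cycles; HasCycles)
  open Perm using (_≈_; id; insert; transpose)
  open ≡
  private
    variable
      a ℓ : Level
      n k : ℕ

  ⟨$⟩ʳ-injective : ∀ (α : Permutation′ n) {i j} → α ⟨$⟩ʳ i ≡ α ⟨$⟩ʳ j → i ≡ j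
  ⟨$⟩ʳ-injective α e = trans (sym (Perm.inverseˡ α)) (trans (cong (α ⟨$⟩ˡ_) e) (Perm.inverseˡ α))

  data PunchView {n} (i : Fin (suc n)) : Fin (suc n) → Set where
    at  : PunchView i i
    off : ∀ j → PunchView i (punchIn i j)

  punchView : ∀ (i k : Fin (suc n)) → PunchView i k
  punchView i k with i Fin.≟ k
  ... | yes refl = at
  ... | no  i≢k  = subst (PunchView i) (Fin.punchIn-punchOut i≢k) (off (punchOut i≢k))

  -- α arises from α′ by inserting i with α(i) = t.
  record Extends (i t : Fin (suc n)) (α : Permutation′ (suc n)) (α′ : Permutation′ n) : Set where
    field
      image : α ⟨$⟩ʳ i ≡ t
      rest  : ∀ j → α ⟨$⟩ʳ punchIn i j ≡ punchIn i (α′ ⟨$⟩ʳ j) ⊎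
                    (α ⟨$⟩ʳ punchIn i j ≡ i × punchIn i (α′ ⟨$⟩ʳ j) ≡ t)

  private
    transpose-first : ∀ (i j : Fin n) → PC.transpose i j i ≡ j
    transpose-first i j with i Fin.≟ i
    ... | yes _   = refl
    ... | no  i≢i = contradiction refl i≢i

    transpose-second : ∀ (i j : Fin n) → PC.transpose i j j ≡ i
    transpose-second i j with j Fin.≟ i
    ... | yes j≡i = j≡i
    ... | no  _   with j Fin.≟ j
    ...   | yes _   = refl
    ...   | no  j≢j = contradiction refl j≢j

    transpose-other : ∀ (i j : Fin n) {k} → k ≢ i → k ≢ j → PC.transpose i j k ≡ k
    transpose-other i j {k} k≢i k≢j with k Fin.≟ i
    ... | yes k≡i = contradiction k≡i k≢i
    ... | no  _   with k Fin.≟ j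
    ...   | yes k≡j = contradiction k≡j k≢j
    ...   | no  _   = refl

  delete-extends : ∀ (i : Fin (suc n)) α → Extends i (α ⟨$⟩ʳ i) α (delete i α)
  delete-extends i α = record { image = refl ; rest = rest }
    where
    t = α ⟨$⟩ʳ i
    β = α ∘ₚ transpose i t

    βi≡i : β ⟨$⟩ʳ i ≡ i
    βi≡i = transpose-second i t

    β-punchIn : ∀ j → punchIn i (delete i α ⟨$⟩ʳ j) ≡ PC.transpose i t (α ⟨$⟩ʳ punchIn i j)
    β-punchIn j = trans (cong (λ l → punchIn l (delete i α ⟨$⟩ʳ j)) (sym βi≡i))
      (sym (Perm.punchIn-permute β i j))

    rest : ∀ j → α ⟨$⟩ʳ punchIn i j ≡ punchIn i (delete i α ⟨$⟩ʳ j) ⊎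
                 (α ⟨$⟩ʳ punchIn i j ≡ i × punchIn i (delete i α ⟨$⟩ʳ j) ≡ t)
    rest j = case α ⟨$⟩ʳ punchIn i j Fin.≟ i of λ where
      (yes e) → inj₂ (e , trans (β-punchIn j) (trans (cong (PC.transpose i t) e) (transpose-first i t)))
      (no ¬e) → inj₁ (sym (trans (β-punchIn j)
        (transpose-other i t ¬e (Fin.punchInᵢ≢i i j ∘ ⟨$⟩ʳ-injective α))))

  -- Inverse to `delete`: i enters as a fixed point, and the transposition then gives it the value t
  -- and hands i to the former preimage of t.
  extend : ∀ (i t : Fin (suc n)) → Permutation′ n → Permutation′ (suc n)
  extend i t α′ = insert i i α′ ∘ₚ transpose i t

  extend-extends : ∀ (i t : Fin (suc n)) α′ → Extends i t (extend i t α′) α′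
  extend-extends i t α′ = record
    { image = trans (cong (PC.transpose i t) insert-i) (transpose-first i t)
    ; rest  = rest
    }
    where
    insert-i : insert i i α′ ⟨$⟩ʳ i ≡ i
    insert-i with i Fin.≟ i
    ... | yes _   = refl
    ... | no  i≢i = contradiction refl i≢i

    rest : ∀ j → extend i t α′ ⟨$⟩ʳ punchIn i j ≡ punchIn i (α′ ⟨$⟩ʳ j) ⊎
                 (extend i t α′ ⟨$⟩ʳ punchIn i j ≡ i × punchIn i (α′ ⟨$⟩ʳ j) ≡ t)
    rest j = case punchIn i (α′ ⟨$⟩ʳ j) Fin.≟ t of λ where
      (yes e) → inj₂ (trans (cong (PC.transpose i t) (trans (Perm.insert-punchIn i i α′ j) e))
                          (transpose-second i t) , e)
      (no ¬e) → inj₁ (trans (cong (PC.transpose i t) (Perm.insert-punchIn i i α′ j))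
                          (transpose-other i t (Fin.punchInᵢ≢i i _) ¬e))

  module _ {i t : Fin (suc n)} {α α′} (α-ext : Extends i t α α′) where
    open Extends α-ext

    module _ {s β β′} (β-ext : Extends i s β β′) where

      -- The critical j is the predecessor of i under α. There α has the value i and α′ the value t,
      -- and the hypotheses deny these to β and β′, so that neither pair agrees.
      agree-off : ∀ {j} → β ⟨$⟩ʳ punchIn i j ≢ i → punchIn i (β′ ⟨$⟩ʳ j) ≢ t →
                  (α ⟨$⟩ʳ punchIn i j ≡ β ⟨$⟩ʳ punchIn i j → α′ ⟨$⟩ʳ j ≡ β′ ⟨$⟩ʳ j) ×
                  (α′ ⟨$⟩ʳ j ≡ β′ ⟨$⟩ʳ j → α ⟨$⟩ʳ punchIn i j ≡ β ⟨$⟩ʳ punchIn i j)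
      agree-off {j} β≢i β′≢t with Extends.rest β-ext j | rest j
      ... | inj₂ (e , _) | _            = contradiction e β≢i
      ... | inj₁ b       | inj₁ a       =
        (λ e → Fin.punchIn-injective i _ _ (trans (sym a) (trans e b))) ,
        (λ e → trans a (trans (cong (punchIn i) e) (sym b)))
      ... | inj₁ b       | inj₂ (a , c) =
        (λ e → contradiction (trans (sym e) a) β≢i) ,
        (λ e → contradiction (trans (cong (punchIn i) (sym e)) c) β′≢t)

    module _ {β β′} (β-ext : Extends i t β β′) where

      -- Here i has the same image t on both sides. If j precedes i for one permutation only,
      -- agreement of α′ and β′ at j would make the other take the value t both there and at i.
      agree : ∀ {j} →
              (α ⟨$⟩ʳ punchIn i j ≡ β ⟨$⟩ʳ punchIn i j → α′ ⟨$⟩ʳ j ≡ β′ ⟨$⟩ʳ j) ×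
              (α′ ⟨$⟩ʳ j ≡ β′ ⟨$⟩ʳ j → α ⟨$⟩ʳ punchIn i j ≡ β ⟨$⟩ʳ punchIn i j)
      agree {j} with Extends.rest β-ext j | rest j
      ... | inj₁ b       | inj₁ a       =
        (λ e → Fin.punchIn-injective i _ _ (trans (sym a) (trans e b))) ,
        (λ e → trans a (trans (cong (punchIn i) e) (sym b)))
      ... | inj₁ b       | inj₂ (a , c) =
        (λ e → contradiction (sym (trans (sym a) (trans e b))) (Fin.punchInᵢ≢i i _)) ,
        (λ e → contradiction
          (⟨$⟩ʳ-injective β (trans b (trans (cong (punchIn i) (sym e)) (trans c (sym (Extends.image β-ext))))))
          (Fin.punchInᵢ≢i i j))
      ... | inj₂ (b , c) | inj₁ a       =
        (λ e → contradiction (trans (sym a) (trans e b)) (Fin.punchInᵢ≢i i _)) ,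
        (λ e → contradiction
          (⟨$⟩ʳ-injective α (trans a (trans (cong (punchIn i) e) (trans c (sym image)))))
          (Fin.punchInᵢ≢i i j))
      ... | inj₂ (b , c) | inj₂ (a , d) =
        (λ _ → Fin.punchIn-injective i _ _ (trans d (sym c))) ,
        (λ _ → trans a (sym b))

  module _ {i t : Fin (suc n)} {α β α′ β′}
    (α-ext : Extends i t α α′) (β-ext : Extends i t β β′) where

    Extends-unique : α ≈ β → α′ ≈ β′
    Extends-unique α≈β j = proj₁ (agree α-ext β-ext) (α≈β (punchIn i j))

    Extends-injective : α′ ≈ β′ → α ≈ β
    Extends-injective α′≈β′ k with punchView i k
    ... | at    = trans (Extends.image α-ext) (sym (Extends.image β-ext))
    ... | off j = proj₂ (agree α-ext β-ext) (α′≈β′ j)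

  id-extends : ∀ (i : Fin (suc n)) → Extends i i id id
  id-extends i = record { image = refl ; rest = λ _ → inj₁ refl }

  ζ-last : ∀ {i : Fin (suc n)} → toℕ i ≡ n → ζ (suc n) ⟨$⟩ʳ i ≡ zero
  ζ-last {n} {i} e with fromℕ n Fin.≟ i
  ... | yes _ = refl
  ... | no ¬e = contradiction (Fin.toℕ-injective (trans (Fin.toℕ-fromℕ n) (sym e))) ¬e

  punchIn-< : ∀ {i : Fin (suc n)} {j} → toℕ j < toℕ i → toℕ (punchIn i j) ≡ toℕ j
  punchIn-< {i = suc i} {zero}  _         = refl
  punchIn-< {i = suc i} {suc j} (s≤s j<i) = cong suc (punchIn-< j<i)

  punchIn-≥ : ∀ {i : Fin (suc n)} {j} → toℕ i ≤ toℕ j → toℕ (punchIn i j) ≡ suc (toℕ j)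
  punchIn-≥ {i = zero}             _         = refl
  punchIn-≥ {i = suc i} {suc j}    (s≤s i≤j) = cong suc (punchIn-≥ i≤j)

  ζ-< : ∀ {i : Fin (suc n)} → toℕ i < n → toℕ (ζ (suc n) ⟨$⟩ʳ i) ≡ suc (toℕ i)
  ζ-< {n} {i} i<n with punchView (fromℕ n) i
  ... | at    = contradiction (Fin.toℕ-fromℕ n) (ℕ.<⇒≢ i<n)
  ... | off j = trans (cong toℕ (Perm.insert-punchIn (fromℕ n) zero id j))
      (cong suc (sym (punchIn-< (subst (toℕ j <_) (sym (Fin.toℕ-fromℕ n)) (Fin.toℕ<n j)))))

  ζ≢ : ∀ (i : Fin (suc (suc n))) → ζ _ ⟨$⟩ʳ i ≢ i
  ζ≢ {n} i e with ℕ.m≤n⇒m<n∨m≡n (Fin.toℕ≤pred[n] i)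
  ... | inj₁ i<n = ℕ.1+n≢n (trans (sym (ζ-< i<n)) (cong toℕ e))
  ... | inj₂ i≡n with trans (sym (cong toℕ (trans (sym e) (ζ-last i≡n)))) i≡n
  ...   | ()

  -- Deleting any point of the long cycle leaves the long cycle. Hence dual fixed points, as
  -- agreements with ζ, survive deletions through `agree` just as fixed points do.
  ζ-extends : ∀ (i : Fin (suc n)) → Extends i (ζ (suc n) ⟨$⟩ʳ i) (ζ (suc n)) (ζ n)
  ζ-extends {zero}  i = record { image = refl ; rest = λ () }
  ζ-extends {suc n} i = record { image = refl ; rest = rest }
    where
    ζ₁ = ζ (suc (suc n)) ⟨$⟩ʳ_
    ζ₀ = ζ (suc n) ⟨$⟩ʳ_

    from-toℕ : ∀ {m} {a b : Fin m} {c} → toℕ a ≡ c → toℕ b ≡ c → a ≡ b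
    from-toℕ a≡c b≡c = Fin.toℕ-injective (trans a≡c (sym b≡c))

    rest : ∀ j → ζ₁ (punchIn i j) ≡ punchIn i (ζ₀ j) ⊎ (ζ₁ (punchIn i j) ≡ i × punchIn i (ζ₀ j) ≡ ζ₁ i)
    rest j with ℕ.m≤n⇒m<n∨m≡n (Fin.toℕ≤pred[n] j) | ℕ.≤-<-connex (toℕ i) (toℕ j)
    ... | inj₁ j<n | inj₁ i≤j = inj₁ (from-toℕ
      (trans (ζ-< (subst (_< suc n) (sym (punchIn-≥ i≤j)) (s≤s j<n))) (cong suc (punchIn-≥ i≤j)))
      (trans (punchIn-≥ (subst (toℕ i ≤_) (sym (ζ-< j<n)) (ℕ.m≤n⇒m≤1+n i≤j))) (cong suc (ζ-< j<n))))
    ... | inj₁ j<n | inj₂ j<i with ℕ.m≤n⇒m<n∨m≡n j<i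
    ...   | inj₁ 1+j<i = inj₁ (from-toℕ
      (trans (ζ-< (subst (_< suc n) (sym (punchIn-< j<i)) (ℕ.m<n⇒m<1+n j<n))) (cong suc (punchIn-< j<i)))
      (trans (punchIn-< (subst (_< toℕ i) (sym (ζ-< j<n)) 1+j<i)) (ζ-< j<n)))
    ...   | inj₂ 1+j≡i = inj₂
      ( from-toℕ (trans (ζ-< (subst (_< suc n) (sym (punchIn-< j<i)) (ℕ.m<n⇒m<1+n j<n)))
                        (cong suc (punchIn-< j<i))) (sym 1+j≡i)
      , from-toℕ
          (trans (punchIn-≥ (ℕ.≤-reflexive (trans (sym 1+j≡i) (sym (ζ-< j<n))))) (cong suc (ζ-< j<n)))
          (trans (ζ-< (subst (_< suc n) 1+j≡i (s≤s j<n))) (cong suc (sym 1+j≡i))))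
    rest j | inj₂ j≡n | inj₂ j<i = inj₂
      ( from-toℕ (trans (ζ-< (subst (_< suc n) (sym (punchIn-< j<i)) (s≤s (ℕ.≤-reflexive j≡n))))
                        (trans (cong suc (punchIn-< j<i)) (cong suc j≡n))) i≡1+n
      , from-toℕ (trans (cong (toℕ ∘ punchIn i) (ζ-last j≡n)) (punchIn-< {i = i} {zero} (ℕ.≤-<-trans z≤n j<i)))
                 (cong toℕ (ζ-last i≡1+n)))
      where
      i≡1+n : toℕ i ≡ suc n
      i≡1+n = ℕ.≤-antisym (Fin.toℕ≤pred[n] i) (subst (_< toℕ i) j≡n j<i)
    -- Here `punchIn i j` is the last point, with value 0. It precedes i exactly if i = 0.
    rest j | inj₂ j≡n | inj₁ i≤j = last i (ζ-last (trans (punchIn-≥ i≤j) (cong suc j≡n)))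
      where
      last : ∀ i → ζ₁ (punchIn i j) ≡ zero →
             ζ₁ (punchIn i j) ≡ punchIn i (ζ₀ j) ⊎ (ζ₁ (punchIn i j) ≡ i × punchIn i (ζ₀ j) ≡ ζ₁ i)
      last zero    e = inj₂ (e , from-toℕ (cong (λ z → suc (toℕ z)) (ζ-last j≡n)) (ζ-< {suc n} {zero} (s≤s z≤n)))
      last (suc i) e = inj₁ (trans e (sym (cong (punchIn (suc i)) (ζ-last j≡n))))

  fromBijective : ∀ (S : Setoid a ℓ) (f : Fin k → Setoid.Carrier S) →
                  (∀ {i j} → Setoid._≈_ S (f i) (f j) → i ≡ j) →
                  (∀ s → ∃ λ i → Setoid._≈_ S (f i) s) → HasCardinality S k
  fromBijective S f inj surj = record
    { to        = f
    ; cong      = λ { refl → S.refl }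
    ; bijective = inj , λ s → proj₁ (surj s) , λ { refl → proj₂ (surj s) }
    }
    where module S = Setoid S

  module _ {i t : Fin (suc n)} {α α′} (ext : Extends i t α α′) where
    open Extends ext
    private
      module α  = Setoid (cycles α)
      module α′ = Setoid (cycles α′)

    -- A left inverse of `punchIn i`, with a default `d` for the deleted point.
    contract : Fin n → Fin (suc n) → Fin n
    contract d k with i Fin.≟ k
    ... | yes _   = d
    ... | no  i≢k = punchOut i≢k

    contract-at : ∀ {d} → contract d i ≡ d
    contract-at with i Fin.≟ i
    ... | yes _   = refl
    ... | no  i≢i = contradiction refl i≢i

    contract-off : ∀ {d} j → contract d (punchIn i j) ≡ j
    contract-off j with i Fin.≟ punchIn i j
    ... | yes e   = contradiction (sym e) (Fin.punchInᵢ≢i i j)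
    ... | no  i≢k = trans (Fin.punchOut-cong i refl) (Fin.punchOut-punchIn i)

    punchIn-cong : ∀ {j j′} → j α′.≈ j′ → punchIn i j α.≈ punchIn i j′
    punchIn-cong = Eq.gfold (Eq.isEquivalence _) (punchIn i) step
      where
      step : ∀ {j j′} → α′ ⟨$⟩ʳ j ≡ j′ → punchIn i j α.≈ punchIn i j′
      step {j} refl with rest j
      ... | inj₁ a       = Eq.return a
      ... | inj₂ (a , e) = α.trans (Eq.return a) (Eq.return (trans image (sym e)))

    -- The deleted point lies in the cycle of its image t, so contracting it onto t identifies the
    -- cycles of α with those of α′.
    module Dual (i≢t : i ≢ t) where

      private
        t′ = punchOut i≢t
        g = contract t′

      punchIn-g : ∀ k → punchIn i (g k) α.≈ k
      punchIn-g k with punchView i k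
      ... | at    = α.sym (Eq.return (trans image
        (trans (sym (Fin.punchIn-punchOut i≢t)) (cong (punchIn i) (sym contract-at)))))
      ... | off j = α.reflexive (cong (punchIn i) (contract-off j))

      g-cong : ∀ {k k′} → k α.≈ k′ → g k α′.≈ g k′
      g-cong = Eq.gfold (Eq.isEquivalence _) g step
        where
        step : ∀ {k k′} → α ⟨$⟩ʳ k ≡ k′ → g k α′.≈ g k′
        step {k} refl with punchView i k
        ... | at    = α′.reflexive (trans contract-at (sym (trans
          (cong g (trans image (sym (Fin.punchIn-punchOut i≢t)))) (contract-off t′))))
        ... | off j with rest j
        ...   | inj₁ a       = Eq.return (trans (cong (α′ ⟨$⟩ʳ_) (contract-off j))
          (sym (trans (cong g a) (contract-off _))))
        ...   | inj₂ (a , e) = Eq.return (trans (cong (α′ ⟨$⟩ʳ_) (contract-off j))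
          (trans (Fin.punchIn-injective i _ _ (trans e (sym (Fin.punchIn-punchOut i≢t))))
            (sym (trans (cong g a) contract-at))))

      punchIn-reflects : ∀ {j j′} → punchIn i j α.≈ punchIn i j′ → j α′.≈ j′
      punchIn-reflects {j} {j′} e =
        subst₂ α′._≈_ (contract-off j) (contract-off j′) (g-cong e)

      dual-cycles : HasCycles α k → HasCycles α′ k
      dual-cycles b = fromBijective (cycles α′) (g ∘ b.to)
        (λ e → b.injective (α.trans (α.sym (punchIn-g _)) (α.trans (punchIn-cong e) (punchIn-g _))))
        (λ j → let (c , e) = b.strictlySurjective (punchIn i j) in
          c , α′.trans (g-cong e) (α′.reflexive (contract-off j)))
        where module b = Bijection b

      dual-cycles⁻¹ : HasCycles α′ k → HasCycles α k
      dual-cycles⁻¹ b = fromBijective (cycles α) (punchIn i ∘ b.to)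
        (λ e → b.injective (punchIn-reflects e))
        (λ k → let (c , e) = b.strictlySurjective (g k) in
          c , α.trans (punchIn-cong e) (punchIn-g k))
        where module b = Bijection b

    module Fixed (i≡t : i ≡ t) where

      private
        αi≡i : α ⟨$⟩ʳ i ≡ i
        αi≡i = trans image (sym i≡t)

        off-step : ∀ j → α ⟨$⟩ʳ punchIn i j ≡ punchIn i (α′ ⟨$⟩ʳ j)
        off-step j with rest j
        ... | inj₁ a       = a
        ... | inj₂ (_ , e) = contradiction (trans e (sym i≡t)) (Fin.punchInᵢ≢i i _)

      isolated : ∀ {k k′} → k α.≈ k′ → (k ≡ i → k′ ≡ i) × (k′ ≡ i → k ≡ i)
      isolated = Eq.fold {S = λ k k′ → (k ≡ i → k′ ≡ i) × (k′ ≡ i → k ≡ i)}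
        (record { refl = (λ e → e) , (λ e → e)
                ; sym = λ (f , g) → g , f
                ; trans = λ (f , g) (f′ , g′) → f′ ∘ f , g ∘ g′ })
        (λ { {k} refl → (λ e → trans (cong (α ⟨$⟩ʳ_) e) αi≡i)
                      , (λ e → ⟨$⟩ʳ-injective α (trans e (sym αi≡i))) })

      contract-cong : ∀ d {k k′} → k α.≈ k′ → contract d k α′.≈ contract d k′
      contract-cong d = Eq.gfold (Eq.isEquivalence _) (contract d) step
        where
        step : ∀ {k k′} → α ⟨$⟩ʳ k ≡ k′ → contract d k α′.≈ contract d k′
        step {k} refl with punchView i k
        ... | at    = α′.reflexive (cong (contract d) (sym αi≡i))
        ... | off j = Eq.return (trans (cong (α′ ⟨$⟩ʳ_) (contract-off j))
          (sym (trans (cong (contract d) (off-step j)) (contract-off _))))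

      punchIn-reflects : ∀ {j j′} → punchIn i j α.≈ punchIn i j′ → j α′.≈ j′
      punchIn-reflects {j} {j′} e =
        -- The default never matters for points other than i; `j` is an element at hand.
        subst₂ α′._≈_ (contract-off j) (contract-off j′) (contract-cong j e)

      fixed-cycles-nonzero : ¬ HasCycles α 0
      fixed-cycles-nonzero b with Bijection.strictlySurjective b i
      ... | () , _

      -- The class numbered `c₀` is that of i alone. Skipping this number leaves representatives
      -- different from i, which can be punched out.
      fixed-cycles : HasCycles α (suc k) → HasCycles α′ k
      fixed-cycles {k} b = fromBijective (cycles α′) f
        (λ e → Fin.punchIn-injective c₀ _ _ (b.injective
          (subst₂ α._≈_ (f-eqn _) (f-eqn _) (punchIn-cong e))))
        surj
        where
        module b = Bijection b
        c₀ = proj₁ (b.strictlySurjective i)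
        bc₀≈i = proj₂ (b.strictlySurjective i)
        i≢b : ∀ c → i ≢ b.to (punchIn c₀ c)
        i≢b c e = Fin.punchInᵢ≢i c₀ c (b.injective (α.trans (α.reflexive (sym e)) (α.sym bc₀≈i)))
        f : Fin k → Fin n
        f c = punchOut (i≢b c)
        f-eqn : ∀ c → punchIn i (f c) ≡ b.to (punchIn c₀ c)
        f-eqn c = Fin.punchIn-punchOut (i≢b c)
        surj : ∀ j → ∃ λ c → f c α′.≈ j
        surj j with b.strictlySurjective (punchIn i j)
        ... | d , e with punchView c₀ d
        ...   | at    = contradiction (proj₁ (isolated (α.trans (α.sym bc₀≈i) e)) refl) (Fin.punchInᵢ≢i i j)
        ...   | off c = c , punchIn-reflects (subst (α._≈ punchIn i j) (sym (f-eqn c)) e)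

      fixed-cycles⁻¹ : HasCycles α′ k → HasCycles α (suc k)
      fixed-cycles⁻¹ {k} b = fromBijective (cycles α) f inj surj
        where
        module b = Bijection b
        f : Fin (suc k) → Fin (suc n)
        f zero    = i
        f (suc c) = punchIn i (b.to c)
        inj : ∀ {c c′} → f c α.≈ f c′ → c ≡ c′
        inj {zero}  {zero}   e = refl
        inj {zero}  {suc c′} e = contradiction (proj₁ (isolated e) refl) (Fin.punchInᵢ≢i i _)
        inj {suc c} {zero}   e = contradiction (proj₂ (isolated e) refl) (Fin.punchInᵢ≢i i _)
        inj {suc c} {suc c′} e = cong suc (b.injective (punchIn-reflects e))
        surj : ∀ k → ∃ λ c → f c α.≈ k
        surj k with punchView i k
        ... | at    = zero , α.refl
        ... | off j = let (c , e) = b.strictlySurjective j in suc c , punchIn-cong e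

-- Cardinalities of sets of permutations

module Counting where

  open import Defs
    hiding (_+_; _*_; _-_; _^_)
  open Perm using (_≈_; id)
  open import Data.Nat.Base using (_+_)
  open ≡ hiding (resp)
  open PointInsertion
  private
    variable
      a b ℓ ℓ′ : Level
      n n′ k l m : ℕ

  card-≤ : ∀ {S : Setoid a ℓ} {T : Setoid b ℓ′} → HasCardinality S l → HasCardinality T m →
           (f : Setoid.Carrier S → Setoid.Carrier T) →
           (∀ s t → Setoid._≈_ T (f s) (f t) → Setoid._≈_ S s t) → l ≤ m
  card-≤ {S = S} {T} cs ct f inj = Fin.injective⇒≤ {f = index ∘ f ∘ S.to} λ {i} {j} e →
    S.injective (inj _ _ (Setoid.trans T (Setoid.sym T (index-eqn (f (S.to i))))
      (subst (λ c → Setoid._≈_ T (T.to c) (f (S.to j))) (sym e) (index-eqn (f (S.to j))))))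
    where
    module S = Bijection cs
    module T = Bijection ct
    index : Setoid.Carrier T → Fin _
    index t = proj₁ (T.strictlySurjective t)
    index-eqn : ∀ t → Setoid._≈_ T (T.to (index t)) t
    index-eqn t = proj₂ (T.strictlySurjective t)

  module _ {P : Permutation′ n → Set ℓ} {Q : Permutation′ n → Set ℓ′} where

    card-⇔ : HasCardinality (permutationsWith n P) l → HasCardinality (permutationsWith n Q) m →
             (∀ α → P α → Q α) → (∀ α → Q α → P α) → l ≡ m
    card-⇔ cp cq P⇒Q Q⇒P = ℕ.≤-antisym
      (card-≤ cp cq (λ (α , p) → α , P⇒Q α p) (λ _ _ e → e))
      (card-≤ cq cp (λ (α , q) → α , Q⇒P α q) (λ _ _ e → e))

  card-split : {P : Permutation′ n → Set ℓ} {C : Permutation′ n → Set ℓ′} →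
               (∀ {α β} → α ≈ β → C α → C β) → (∀ α → Dec (C α)) →
               HasCardinality (permutationsWith n P) k →
               HasCardinality (permutationsWith n (λ α → P α × ¬ C α)) l →
               HasCardinality (permutationsWith n (λ α → P α × C α)) m →
               k ≡ l + m
  card-split {n = n} {l = l} {m = m} {P = P} {C} C-resp C? cp cn cc =
    card-⇔ cp (fromBijective (permutationsWith n P) (f ∘ Fin.splitAt l) inj surj) (λ _ p → p) (λ _ p → p)
    where
    module N = Bijection cn
    module C = Bijection cc
    f : Fin l ⊎ Fin m → Setoid.Carrier (permutationsWith n P)
    f (inj₁ i) = let (α , p , _) = N.to i in α , p
    f (inj₂ i) = let (α , p , _) = C.to i in α , p
    f-inj : ∀ s t → proj₁ (f s) ≈ proj₁ (f t) → s ≡ t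
    f-inj (inj₁ i) (inj₁ j) e = cong inj₁ (N.injective e)
    f-inj (inj₁ i) (inj₂ j) e = contradiction (C-resp (λ k → sym (e k)) (proj₂ (proj₂ (C.to j)))) (proj₂ (proj₂ (N.to i)))
    f-inj (inj₂ i) (inj₁ j) e = contradiction (C-resp e (proj₂ (proj₂ (C.to i)))) (proj₂ (proj₂ (N.to j)))
    f-inj (inj₂ i) (inj₂ j) e = cong inj₂ (C.injective e)
    inj : ∀ {i j} → proj₁ (f (Fin.splitAt l i)) ≈ proj₁ (f (Fin.splitAt l j)) → i ≡ j
    inj {i} {j} e = trans (sym (Fin.join-splitAt l m i))
      (trans (cong (Fin.join l m) (f-inj (Fin.splitAt l i) (Fin.splitAt l j) e)) (Fin.join-splitAt l m j))
    cover : ∀ s → ∃ λ t → proj₁ (f t) ≈ proj₁ s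
    cover (α , p) with C? α
    ... | yes c = let (i , e) = C.strictlySurjective (α , p , c) in inj₂ i , e
    ... | no ¬c = let (i , e) = N.strictlySurjective (α , p , ¬c) in inj₁ i , e
    surj : ∀ s → ∃ λ i → proj₁ (f (Fin.splitAt l i)) ≈ proj₁ s
    surj s = let (t , e) = cover s in Fin.join l m t ,
      subst (λ t → proj₁ (f t) ≈ proj₁ s) (sym (Fin.splitAt-join l m t)) e

  record Enumeration {n} (C : Fin n → Set ℓ) : Set ℓ where
    field
      size       : ℕ
      element    : Fin size → Fin n
      injective  : ∀ {i j} → element i ≡ element j → i ≡ j
      sound      : ∀ i → C (element i)
      complete   : ∀ {j} → C j → ∃ λ i → element i ≡ j

  enumerate : ∀ {n} {C : Fin n → Set ℓ} → (∀ i → Dec (C i)) → Enumeration C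
  enumerate {n = zero}  C? = record
    { size = 0 ; element = λ () ; injective = λ { {()} } ; sound = λ () ; complete = λ { {()} } }
  enumerate {n = suc n} {C} C? with enumerate (C? ∘ suc) | C? zero
  ... | e | no ¬c = record
    { size      = e.size
    ; element   = suc ∘ e.element
    ; injective = e.injective ∘ Fin.suc-injective
    ; sound     = e.sound
    ; complete  = complete
    }
    where
    module e = Enumeration e
    complete : ∀ {j} → C j → ∃ λ i → suc (e.element i) ≡ j
    complete {zero}  c = contradiction c ¬c
    complete {suc j} c = let (i , p) = e.complete c in i , cong suc p
  ... | e | yes c = record
    { size      = suc e.size
    ; element   = element
    ; injective = injective
    ; sound     = λ { zero → c ; (suc i) → e.sound i }
    ; complete  = complete
    }
    where
    module e = Enumeration e
    element : Fin (suc e.size) → Fin (suc n)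
    element zero    = zero
    element (suc i) = suc (e.element i)
    injective : ∀ {i j} → element i ≡ element j → i ≡ j
    injective {zero}  {zero}  _ = refl
    injective {suc i} {suc j} p = cong suc (e.injective (Fin.suc-injective p))
    complete : ∀ {j} → C j → ∃ λ i → element i ≡ j
    complete {zero}  _ = zero , refl
    complete {suc j} c = let (i , p) = e.complete c in suc i , cong suc p

  -- Provides numbers for the intermediate patterns, for which no count is given: the filter runs
  -- through a known enumeration of P and decides C only.
  card-filter : {P : Permutation′ n → Set ℓ} {C : Permutation′ n → Set ℓ′} →
                (∀ {α β} → α ≈ β → C α → C β) → (∀ α → Dec (C α)) →
                HasCardinality (permutationsWith n P) l →
                ∃ λ m → HasCardinality (permutationsWith n (λ α → P α × C α)) m
  card-filter {n = n} {P = P} {C} C-resp C? cp = e.size , fromBijective (permutationsWith n (λ α → P α × C α))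
    (λ i → let (α , p) = P.to (e.element i) in α , p , e.sound i)
    (λ eq → e.injective (P.injective eq))
    (λ (α , p , c) →
      let (i , eᵢ) = P.strictlySurjective (α , p)
          (j , eⱼ) = e.complete (C-resp (λ k → sym (eᵢ k)) c)
      in j , λ k → trans (cong (λ i → proj₁ (P.to i) ⟨$⟩ʳ k) eⱼ) (eᵢ k))
    where
    module P = Bijection cp
    module e = Enumeration (enumerate (λ i → C? (proj₁ (P.to i))))

  -- Conditions, patterns and their behaviour under deletion

  data Kind : Set where
    fixed dual : Kind

  -- Fixed points and dual fixed points are points of agreement with this permutation.
  model : Kind → ∀ n → Permutation′ n
  model fixed n = id
  model dual  n = ζ n

  model-extends : ∀ κ (i : Fin (suc n)) → Extends i (model κ (suc n) ⟨$⟩ʳ i) (model κ (suc n)) (model κ n)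
  model-extends fixed = id-extends
  model-extends dual  = ζ-extends

  model-distinct : ∀ {κ κ′} (i : Fin (suc (suc n))) → κ ≢ κ′ →
                   model κ _ ⟨$⟩ʳ i ≢ model κ′ _ ⟨$⟩ʳ i
  model-distinct {κ = fixed} {fixed} i κ≢κ′ e = κ≢κ′ refl
  model-distinct {κ = fixed} {dual}  i κ≢κ′ e = ζ≢ i (sym e)
  model-distinct {κ = dual}  {fixed} i κ≢κ′ e = ζ≢ i e
  model-distinct {κ = dual}  {dual}  i κ≢κ′ e = κ≢κ′ refl

  _≟ᴷ_ : (κ κ′ : Kind) → Dec (κ ≡ κ′)
  fixed ≟ᴷ fixed = yes refl
  fixed ≟ᴷ dual  = no λ ()
  dual  ≟ᴷ fixed = no λ ()
  dual  ≟ᴷ dual  = yes refl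

  addCycle : Kind → ℕ → ℕ
  addCycle fixed k = suc k
  addCycle dual  k = k

  Hits : Kind → Fin n → Permutation′ n → Set
  Hits {n} κ i α = α ⟨$⟩ʳ i ≡ model κ n ⟨$⟩ʳ i

  Pattern : ℕ → Set₁
  Pattern n = Kind → Fin n → Set

  Avoids : Pattern n → Permutation′ n → Set
  Avoids X α = ∀ κ i → X κ i → ¬ Hits κ i α

  Avoids-resp : ∀ (X : Pattern n) {α β} → α ≈ β → Avoids X α → Avoids X β
  Avoids-resp X α≈β av κ i x e = av κ i x (trans (α≈β i) e)

  Avoids? : ∀ (X : Pattern n) → (∀ κ i → Dec (X κ i)) → ∀ α → Dec (Avoids X α)
  Avoids? {n} X X? α = map′
    (λ { (f , d) fixed → f ; (f , d) dual → d }) (λ av → av fixed , av dual)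
    (per fixed ×-dec per dual)
    where
    per : ∀ κ → Dec (∀ i → X κ i → ¬ Hits κ i α)
    per κ = Fin.all? λ i → X? κ i →-dec ¬? (α ⟨$⟩ʳ i Fin.≟ model κ n ⟨$⟩ʳ i)

  -- X⁺ also avoids (κ , i), and X′ is what avoiding X becomes on removal of a
  -- point i that hits κ.  Of the conditions of the other kind, the two that
  -- share the image or the preimage of i are incompatible with (κ , i), and they
  -- merge with it into one that is not in X′.
  record Branching (κ : Kind) (i : Fin (suc n)) (X X⁺ : Pattern (suc n)) (X′ : Pattern n) : Set where
    field
      ∉X      : ¬ X κ i
      X⇒X⁺    : ∀ {κ′ j} → X κ′ j → X⁺ κ′ j
      ∈X⁺     : X⁺ κ i
      X⁺⇒X    : ∀ {κ′ j} → X⁺ κ′ j → X κ′ j ⊎ (κ′ ≡ κ × j ≡ i)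
      same-⇒  : ∀ {j} → X κ (punchIn i j) → X′ κ j
      same-⇐  : ∀ {j} → X′ κ j → X κ (punchIn i j)
      other-⇒ : ∀ {κ′ j} → κ′ ≢ κ →
                model κ′ _ ⟨$⟩ʳ punchIn i j ≢ i →
                punchIn i (model κ′ _ ⟨$⟩ʳ j) ≢ model κ _ ⟨$⟩ʳ i →
                X κ′ (punchIn i j) → X′ κ′ j
      other-⇐ : ∀ {κ′ j} → κ′ ≢ κ → X′ κ′ j →
                model κ′ _ ⟨$⟩ʳ punchIn i j ≢ i ×
                punchIn i (model κ′ _ ⟨$⟩ʳ j) ≢ model κ _ ⟨$⟩ʳ i ×
                X κ′ (punchIn i j)

  module _ {κ κ′} {i : Fin (suc n)} {α α′} (ext : Extends i (model κ _ ⟨$⟩ʳ i) α α′)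
    {j} (κ′≢κ : κ′ ≢ κ) (hit : Hits κ′ (punchIn i j) α) where

    -- For a fixed point i, a dual condition with image i would give α the value i at two points.
    -- For a dual one the claim is that `punchIn i` misses i; `clash-image` has these roles
    -- exchanged.
    clash-preimage : model κ′ _ ⟨$⟩ʳ punchIn i j ≢ i
    clash-preimage e = go κ κ′ ext κ′≢κ hit e
      where
      go : ∀ κ κ′ → Extends i (model κ _ ⟨$⟩ʳ i) α α′ → κ′ ≢ κ → Hits κ′ (punchIn i j) α →
           model κ′ _ ⟨$⟩ʳ punchIn i j ≢ i
      go fixed fixed _   κ′≢κ = contradiction refl κ′≢κ
      go dual  dual  _   κ′≢κ = contradiction refl κ′≢κ
      go dual  fixed _   _ _   e = Fin.punchInᵢ≢i i j e
      go fixed dual  ext _ hit e = Fin.punchInᵢ≢i i j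
        (⟨$⟩ʳ-injective α (trans hit (trans e (sym (Extends.image ext)))))

    clash-image : punchIn i (model κ′ _ ⟨$⟩ʳ j) ≢ model κ _ ⟨$⟩ʳ i
    clash-image e = go κ κ′ ext κ′≢κ hit e
      where
      go : ∀ κ κ′ → Extends i (model κ _ ⟨$⟩ʳ i) α α′ → κ′ ≢ κ → Hits κ′ (punchIn i j) α →
           punchIn i (model κ′ _ ⟨$⟩ʳ j) ≢ model κ _ ⟨$⟩ʳ i
      go fixed fixed _   κ′≢κ = contradiction refl κ′≢κ
      go dual  dual  _   κ′≢κ = contradiction refl κ′≢κ
      go fixed dual  _   _ _   e = Fin.punchInᵢ≢i i _ e
      go dual  fixed ext _ hit e = Fin.punchInᵢ≢i i j
        (⟨$⟩ʳ-injective α (trans hit (trans e (sym (Extends.image ext)))))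

  module _ {κ} {i : Fin (suc (suc n))} {X X⁺ X′} (br : Branching κ i X X⁺ X′)
    {α α′} (ext : Extends i (model κ _ ⟨$⟩ʳ i) α α′) where
    open Branching br

    avoids-delete : Avoids X α → Avoids X′ α′
    avoids-delete av κ′ j x e with κ′ ≟ᴷ κ
    ... | yes refl = av κ (punchIn i j) (same-⇐ x) (proj₂ (agree ext (model-extends κ i)) e)
    ... | no κ′≢κ  = let (c₁ , c₂ , c₃) = other-⇐ κ′≢κ x in
      av κ′ (punchIn i j) c₃ (proj₂ (agree-off ext (model-extends κ′ i) c₁ c₂) e)

    avoids-extend : Avoids X′ α′ → Avoids X α
    avoids-extend av κ′ k x e with punchView i k | κ′ ≟ᴷ κ
    ... | at    | yes refl = ∉X x
    ... | at    | no κ′≢κ  = model-distinct i κ′≢κ (trans (sym e) (Extends.image ext))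
    ... | off j | yes refl = av κ j (same-⇒ x) (proj₁ (agree ext (model-extends κ i)) e)
    ... | off j | no κ′≢κ  with model κ′ _ ⟨$⟩ʳ punchIn i j Fin.≟ i | punchIn i (model κ′ _ ⟨$⟩ʳ j) Fin.≟ model κ _ ⟨$⟩ʳ i
    ...   | no c₁ | no c₂ = av κ′ j (other-⇒ κ′≢κ c₁ c₂ x) (proj₁ (agree-off ext (model-extends κ′ i) c₁ c₂) e)
    ...   | yes c | _     = contradiction c (clash-preimage ext κ′≢κ e)
    ...   | no _  | yes c = contradiction c (clash-image ext κ′≢κ e)

  module _ {κ} {i : Fin (suc (suc n))} {α α′} (ext : Extends i (model κ _ ⟨$⟩ʳ i) α α′) where

    cycles-delete : HasCycles α (addCycle κ k) → HasCycles α′ k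
    cycles-delete = go κ ext
      where
      go : ∀ κ → Extends i (model κ _ ⟨$⟩ʳ i) α α′ → HasCycles α (addCycle κ k) → HasCycles α′ k
      go fixed ext = Fixed.fixed-cycles ext refl
      go dual  ext = Dual.dual-cycles ext (ζ≢ i ∘ sym)

    cycles-extend : HasCycles α′ k → HasCycles α (addCycle κ k)
    cycles-extend = go κ ext
      where
      go : ∀ κ → Extends i (model κ _ ⟨$⟩ʳ i) α α′ → HasCycles α′ k → HasCycles α (addCycle κ k)
      go fixed ext = Fixed.fixed-cycles⁻¹ ext refl
      go dual  ext = Dual.dual-cycles⁻¹ ext (ζ≢ i ∘ sym)

  Extends-⟶ : ∀ κ {i : Fin (suc n)} {α α′} → Extends i (model κ _ ⟨$⟩ʳ i) α α′ → α ⟶ α′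
  Extends-⟶ κ {i} {α} {α′} ext = go κ image
    where
    open Extends ext
    delete≈ : delete i α ≈ α′
    delete≈ = Extends-unique (subst (λ t → Extends i t α (delete i α)) image (delete-extends i α)) ext λ _ → refl
    go : ∀ κ → Hits κ i α → α ⟶ α′
    go fixed e = first i e delete≈
    go dual  e = second i e delete≈

  hit-extends : ∀ κ (i : Fin (suc n)) α → Hits κ i α → Extends i (model κ _ ⟨$⟩ʳ i) α (delete i α)
  hit-extends κ i α hit = subst (λ t → Extends i t α (delete i α)) hit (delete-extends i α)

  punchIn-below : ∀ {i : Fin (suc n)} {j} → k ≤ toℕ i →
                  (toℕ (punchIn i j) < k → toℕ j < k) × (toℕ j < k → toℕ (punchIn i j) < k)
  punchIn-below {k = k} {i} {j} k≤i =
    (λ pj<k → ℕ.≤-<-trans j≤pj pj<k) ,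
    (λ j<k → subst (_< k) (sym (punchIn-< (ℕ.<-≤-trans j<k k≤i))) j<k)
    where
    j≤pj : toℕ j ≤ toℕ (punchIn i j)
    j≤pj with ℕ.≤-<-connex (toℕ i) (toℕ j)
    ... | inj₁ i≤j = subst (toℕ j ≤_) (sym (punchIn-≥ i≤j)) (ℕ.n≤1+n _)
    ... | inj₂ j<i = ℕ.≤-reflexive (sym (punchIn-< j<i))

  toℕ-≢ : ∀ {i j : Fin n} {l m} → toℕ i ≡ l → toℕ j ≡ m → l ≢ m → i ≢ j
  toℕ-≢ refl refl l≢m refl = l≢m refl

  -- In the cyclic order fixed 0, dual 0, fixed 1, ... the initial arcs are `Below u u` and
  -- `Below (suc u) u`.
  Below : ℕ → ℕ → Pattern n
  Below u v fixed i = toℕ i < u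
  Below u v dual  i = toℕ i < v

  ButFirst : Pattern n
  ButFirst fixed i = 0 < toℕ i
  ButFirst dual  i = ⊤

  Below? : ∀ u v κ (i : Fin n) → Dec (Below u v κ i)
  Below? u v fixed i = toℕ i ℕ.<? u
  Below? u v dual  i = toℕ i ℕ.<? v

  ButFirst? : ∀ κ (i : Fin n) → Dec (ButFirst κ i)
  ButFirst? fixed i = 0 ℕ.<? toℕ i
  ButFirst? dual  i = yes tt

  <pred⇒suc< : ∀ n → m < pred n → suc m < n
  <pred⇒suc< (suc n) = s≤s

  -- The dual conditions at u - 1 and u merge with the fixed one at u into dual u - 1, which leaves
  -- the arc. For u = 0 the arc is empty, and the truncation `pred 0 = 0` keeps it empty.
  branch-fixed : ∀ (i : Fin (suc n)) → let u = toℕ i in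
                 Branching fixed i (Below u u) (Below (suc u) u) (Below u (pred u))
  branch-fixed {n} i = record
    { ∉X      = ℕ.<-irrefl refl
    ; X⇒X⁺    = λ { {fixed} → ℕ.m<n⇒m<1+n ; {dual} x → x }
    ; ∈X⁺     = ℕ.n<1+n u
    ; X⁺⇒X    = λ { {fixed} j≤i → Sum⊎.map₂ (λ e → refl , Fin.toℕ-injective e) (ℕ.m<1+n⇒m<n∨m≡n j≤i)
                  ; {dual} x → inj₁ x }
    ; same-⇒  = proj₁ (punchIn-below ℕ.≤-refl)
    ; same-⇐  = proj₂ (punchIn-below ℕ.≤-refl)
    ; other-⇒ = λ { {fixed} fixed≢fixed → contradiction refl fixed≢fixed ; {dual} {j} _ c₁ _ → other-⇒ {j} c₁ }
    ; other-⇐ = λ { {fixed} fixed≢fixed → contradiction refl fixed≢fixed ; {dual} {j} _ x → other-⇐ {j} x }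
    }
    where
    u = toℕ i
    other-⇒ : ∀ {j} → ζ _ ⟨$⟩ʳ punchIn i j ≢ i → toℕ (punchIn i j) < u → toℕ j < pred u
    other-⇒ {j} c₁ pj<i with ℕ.m≤n⇒m<n∨m≡n (proj₁ (punchIn-below ℕ.≤-refl) pj<i)
    ... | inj₁ 1+j<i = ℕ.pred-mono-≤ 1+j<i
    ... | inj₂ 1+j≡i = contradiction (Fin.toℕ-injective (trans (ζ-< (ℕ.<-≤-trans pj<i (Fin.toℕ≤pred[n] i)))
      (trans (cong suc (punchIn-< (ℕ.≤-reflexive 1+j≡i))) 1+j≡i))) c₁
    other-⇐ : ∀ {j} → toℕ j < pred u →
              ζ _ ⟨$⟩ʳ punchIn i j ≢ i × punchIn i (ζ _ ⟨$⟩ʳ j) ≢ i × toℕ (punchIn i j) < u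
    other-⇐ {j} j<i-1 =
      toℕ-≢ (trans (ζ-< (ℕ.<-≤-trans pj<i (Fin.toℕ≤pred[n] i))) (cong suc (punchIn-< j<i))) refl (ℕ.<⇒≢ 1+j<i) ,
      Fin.punchInᵢ≢i i _ , pj<i
      where
      1+j<i : suc (toℕ j) < u
      1+j<i = <pred⇒suc< u j<i-1
      j<i : toℕ j < u
      j<i = ℕ.<-trans (ℕ.n<1+n _) 1+j<i
      pj<i : toℕ (punchIn i j) < u
      pj<i = proj₂ (punchIn-below ℕ.≤-refl) j<i

  -- The fixed conditions at u and u + 1 merge with the dual one at u into fixed u. The bound keeps
  -- u + 1 from wrapping around to 0.
  branch-dual : ∀ (i : Fin (suc n)) → let u = toℕ i in u < n →
                Branching dual i (Below (suc u) u) (Below (suc u) (suc u)) (Below u u)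
  branch-dual i i<n = record
    { ∉X      = ℕ.<-irrefl refl
    ; X⇒X⁺    = λ { {fixed} x → x ; {dual} → ℕ.m<n⇒m<1+n }
    ; ∈X⁺     = ℕ.n<1+n u
    ; X⁺⇒X    = λ { {fixed} x → inj₁ x
                  ; {dual} j≤i → Sum⊎.map₂ (λ e → refl , Fin.toℕ-injective e) (ℕ.m<1+n⇒m<n∨m≡n j≤i) }
    ; same-⇒  = proj₁ (punchIn-below ℕ.≤-refl)
    ; same-⇐  = proj₂ (punchIn-below ℕ.≤-refl)
    ; other-⇒ = λ { {fixed} _ c₁ _ pj≤i → proj₁ (punchIn-below ℕ.≤-refl)
                      (ℕ.≤∧≢⇒< (ℕ.≤-pred pj≤i) (c₁ ∘ Fin.toℕ-injective))
                  ; {dual} dual≢dual → contradiction refl dual≢dual }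
    ; other-⇐ = λ { {fixed} {j} _ j<i → Fin.punchInᵢ≢i i j ,
                      toℕ-≢ (punchIn-< j<i) (ζ-< i<n) (ℕ.<⇒≢ (ℕ.m<n⇒m<1+n j<i)) ,
                      ℕ.m<n⇒m<1+n (proj₂ (punchIn-below ℕ.≤-refl) j<i)
                  ; {dual} dual≢dual → contradiction refl dual≢dual }
    }
    where u = toℕ i

  -- At the seam the neighbours are the fixed conditions at the last point and at 0. They merge into
  -- fixed 0, so the free condition moves to the start of the order.
  branch-dual-last : ∀ (i : Fin (suc n)) → toℕ i ≡ n →
                     Branching dual i (Below (suc n) n) (Below (suc n) (suc n)) ButFirst
  branch-dual-last {n} i i≡n = record
    { ∉X      = ℕ.<-irrefl i≡n
    ; X⇒X⁺    = λ { {fixed} x → x ; {dual} → ℕ.m<n⇒m<1+n }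
    ; ∈X⁺     = Fin.toℕ<n i
    ; X⁺⇒X    = λ { {fixed} x → inj₁ x
                  ; {dual} j≤n → Sum⊎.map₂ (λ e → refl , Fin.toℕ-injective (trans e (sym i≡n))) (ℕ.m<1+n⇒m<n∨m≡n j≤n) }
    ; same-⇒  = λ _ → tt
    ; same-⇐  = λ {j} _ → subst (_< n) (sym (pj≡j j)) (Fin.toℕ<n j)
    ; other-⇒ = λ { {fixed} {j} _ _ c₂ _ → ℕ.n≢0⇒n>0 λ j≡0 → c₂ (trans
                      (Fin.toℕ-injective (trans (pj≡j j) j≡0)) (sym (ζ-last i≡n)))
                  ; {dual} dual≢dual → contradiction refl dual≢dual }
    ; other-⇐ = λ { {fixed} {j} _ 0<j → Fin.punchInᵢ≢i i j ,
                      toℕ-≢ (pj≡j j) (cong toℕ (ζ-last i≡n)) (ℕ.>⇒≢ 0<j) ,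
                      Fin.toℕ<n (punchIn i j)
                  ; {dual} dual≢dual → contradiction refl dual≢dual }
    }
    where
    pj≡j : ∀ j → toℕ (punchIn i j) ≡ toℕ j
    pj≡j j = punchIn-< (subst (toℕ j <_) (sym i≡n) (Fin.toℕ<n j))

  -- The neighbours of fixed 0 are the dual conditions at 0 and at the last point. They merge into
  -- the last dual condition, which closes the passage around the seam.
  branch-fixed-first : Branching {n} fixed zero ButFirst (Below (suc n) (suc n)) (Below n (pred n))
  branch-fixed-first {n} = record
    { ∉X      = λ ()
    ; X⇒X⁺    = λ { {fixed} {j} _ → Fin.toℕ<n j ; {dual} {j} _ → Fin.toℕ<n j }
    ; ∈X⁺     = s≤s z≤n
    ; X⁺⇒X    = λ { {fixed} {zero} _ → inj₂ (refl , refl) ; {fixed} {suc j} _ → inj₁ (s≤s z≤n)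
                  ; {dual} _ → inj₁ tt }
    ; same-⇒  = λ {j} _ → Fin.toℕ<n j
    ; same-⇐  = λ _ → s≤s z≤n
    ; other-⇒ = λ { {fixed} fixed≢fixed → contradiction refl fixed≢fixed ; {dual} {j} _ c₁ _ _ → other-⇒ j c₁ }
    ; other-⇐ = λ { {fixed} fixed≢fixed → contradiction refl fixed≢fixed ; {dual} {j} _ x → other-⇐ j x }
    }
    where
    other-⇒ : ∀ {n} (j : Fin n) → ζ (suc n) ⟨$⟩ʳ suc j ≢ zero → toℕ j < pred n
    other-⇒ {suc n} j c = ℕ.≤∧≢⇒< (Fin.toℕ≤pred[n] j) λ j≡n → c (ζ-last (cong suc j≡n))
    other-⇐ : ∀ {n} (j : Fin n) → toℕ j < pred n →
              ζ (suc n) ⟨$⟩ʳ suc j ≢ zero × punchIn zero (ζ n ⟨$⟩ʳ j) ≢ zero × ⊤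
    other-⇐ {suc n} j j<n = toℕ-≢ (ζ-< (s≤s j<n)) refl (λ ()) , (λ ()) , tt

  -- Recurrences for the members of a closed class

  module Class (𝒞 : PermutationClass ℓ)
    (red : ClosedUnderReductions 𝒞) (ext : ClosedUnderExtensions 𝒞) (excl : ExcludesEmpty 𝒞)
    where

    Counts : Pattern n → ℕ → ℕ → Set _
    Counts {n} X k m = HasCardinality
      (permutationsWith n (λ α → (Member 𝒞 α × HasCycles α k) × Avoids X α)) m

    none₀ : ∀ {α : Permutation′ 0} → ¬ Member 𝒞 α
    none₀ {α} mem = excl (resp 𝒞 {0} {α} (λ ()) mem)

    none₁ : ∀ {α : Permutation′ 1} → ¬ Member 𝒞 α
    none₁ {α} mem = none₀ {delete zero α} (red (first zero (only (α ⟨$⟩ʳ zero)) (λ _ → refl)) mem)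
      where
      only : ∀ (i : Fin 1) → i ≡ zero
      only zero = refl

    no-cards : {P : Permutation′ n → Set ℓ} → (∀ α → ¬ P α) → HasCardinality (permutationsWith n P) m → m ≡ 0
    no-cards {m = zero}  ¬P c = refl
    no-cards {m = suc m} ¬P c = let (α , p) = Bijection.to c zero in contradiction p (¬P α)

    module _ {κ} {i : Fin (suc (suc n))} {X X⁺ X′} (br : Branching κ i X X⁺ X′) where
      open Branching br

      private
        Hitting : ℕ → Permutation′ (suc (suc n)) → Set _
        Hitting k α = ((Member 𝒞 α × HasCycles α k) × Avoids X α) × Hits κ i α

        Hits? : ∀ α → Dec (Hits κ i α)
        Hits? α = α ⟨$⟩ʳ i Fin.≟ model κ _ ⟨$⟩ʳ i

        Hits-resp : ∀ {α β : Permutation′ _} → α ≈ β → Hits κ i α → Hits κ i β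
        Hits-resp α≈β e = trans (sym (α≈β i)) e

        -- Deletion and insertion at i are both injective by `Extends-injective` and
        -- `Extends-unique`, and closure under reductions and extensions keeps them inside the
        -- class.
        hitting-count : HasCardinality (permutationsWith _ (Hitting (addCycle κ k))) l →
                        Counts X′ k m → l ≡ m
        hitting-count ch cx = ℕ.≤-antisym
          (card-≤ ch cx
            (λ (α , ((mem , cyc) , av) , hit) → delete i α ,
              (red (Extends-⟶ κ (hit-extends κ i α hit)) mem , cycles-delete {κ = κ} (hit-extends κ i α hit) cyc) ,
              avoids-delete br (hit-extends κ i α hit) av)
            (λ (α , _ , hit) (β , _ , hit′) → Extends-injective (hit-extends κ i α hit) (hit-extends κ i β hit′)))
          (card-≤ cx ch
            (λ (α′ , (mem , cyc) , av) → extend i _ α′ ,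
              ((ext (Extends-⟶ κ (ex α′)) mem , cycles-extend {κ = κ} (ex α′) cyc) ,
               avoids-extend br (ex α′) av) , Extends.image (ex α′))
            (λ (α′ , _) (β′ , _) → Extends-unique (ex α′) (ex β′)))
          where
          ex : ∀ α′ → Extends i (model κ _ ⟨$⟩ʳ i) (extend i _ α′) α′
          ex = extend-extends i _

        missing-count : HasCardinality (permutationsWith _ (λ α →
                          ((Member 𝒞 α × HasCycles α k) × Avoids X α) × ¬ Hits κ i α)) l →
                        Counts X⁺ k m → l ≡ m
        missing-count cm c⁺ = card-⇔ cm c⁺
          (λ α ((mem , av) , ¬hit) → mem , λ κ′ j x hit → case⁺ α av ¬hit hit (X⁺⇒X x))
          (λ α (mem , av) → (mem , λ κ′ j x → av κ′ j (X⇒X⁺ x)) , av κ i ∈X⁺)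
          where
          case⁺ : ∀ α {κ′ j} → Avoids X α → ¬ Hits κ i α → Hits κ′ j α → ¬ (X κ′ j ⊎ (κ′ ≡ κ × j ≡ i))
          case⁺ α av ¬hit hit (inj₁ x)             = av _ _ x hit
          case⁺ α av ¬hit hit (inj₂ (refl , refl)) = ¬hit hit

        split : ∀ {k l m} → Counts X k l → Counts X⁺ k m →
                ∃ λ h → HasCardinality (permutationsWith _ (Hitting k)) h × l ≡ m + h
        split cx c⁺ =
          let (h , ch)  = card-filter (λ {α} {β} → Hits-resp {α} {β}) Hits? cx
              (h′ , cm) = card-filter (λ {α} {β} α≈β ¬h h → ¬h (Hits-resp {β} {α} (λ k → sym (α≈β k)) h)) (¬? ∘ Hits?) cx
          in h , ch , trans (card-split (λ {α} {β} → Hits-resp {α} {β}) Hits? cx cm ch) (cong (_+ h) (missing-count cm c⁺))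

      recurrence : Counts X (addCycle κ k) l → Counts X⁺ (addCycle κ k) m → Counts X′ k n′ → l ≡ m + n′
      recurrence cx c⁺ c′ = let (h , ch , e) = split cx c⁺ in
        trans e (cong (_ +_) (hitting-count ch c′))

      -- A permutation without cycles has no fixed point to delete, so the second summand
      -- disappears; this is the constant term in y of the recurrence.
      recurrence₀ : κ ≡ fixed → Counts X 0 l → Counts X⁺ 0 m → l ≡ m
      recurrence₀ {m = m} refl cx c⁺ = let (h , ch , e) = split cx c⁺ in
        trans e (trans (cong (m +_) (no-cards
          (λ α (((_ , cyc) , _) , hit) → Fixed.fixed-cycles-nonzero (hit-extends fixed i α hit) refl cyc) ch))
          (ℕ.+-identityʳ m))

    module Recurrences {p r : ℕ → ℕ → ℕ} (cp : CountsAll 𝒞 p) (cr : CountsReduced 𝒞 r) where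

      private
        avoiding : ∀ (X : Pattern n) → (∀ κ i → Dec (X κ i)) → ∀ k → ∃ λ m → Counts X k m
        avoiding X X? k = card-filter (λ {α} {β} → Avoids-resp X {α} {β}) (Avoids? X X?) (cp _ k)

      #below : (u v n k : ℕ) → ℕ
      #below u v n k = proj₁ (avoiding {n} (Below u v) (Below? u v) k)

      #butFirst : (n k : ℕ) → ℕ
      #butFirst n k = proj₁ (avoiding {n} ButFirst ButFirst? k)

      private
        below : ∀ u v n k → Counts {n} (Below u v) k (#below u v n k)
        below u v n k = proj₂ (avoiding {n} (Below u v) (Below? u v) k)

        butFirst : ∀ n k → Counts {n} ButFirst k (#butFirst n k)
        butFirst n k = proj₂ (avoiding {n} ButFirst ButFirst? k)

      #below-none : ∀ {u v} k → #below u v 0 k ≡ 0 × #below u v 1 k ≡ 0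
      #below-none {u} {v} k =
        no-cards (λ α ((mem , _) , _) → none₀ {α} mem) (below u v 0 k) ,
        no-cards (λ α ((mem , _) , _) → none₁ {α} mem) (below u v 1 k)

      #butFirst₁ : ∀ k → #butFirst 1 k ≡ 0
      #butFirst₁ k = no-cards (λ α ((mem , _) , _) → none₁ {α} mem) (butFirst 1 k)

      #reduced-none : ∀ k → r 0 k ≡ 0 × r 1 k ≡ 0
      #reduced-none k =
        no-cards (λ α (mem , _) → none₀ {α} mem) (cr 0 k) , no-cards (λ α (mem , _) → none₁ {α} mem) (cr 1 k)

      #all : ∀ n k → p n k ≡ #below 0 0 n k
      #all n k = card-⇔ (cp n k) (below 0 0 n k)
        (λ α mem → mem , λ { fixed _ () ; dual _ () }) (λ α (mem , _) → mem)

      #reduced : ∀ n k → #below n n n k ≡ r n k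
      #reduced n k = card-⇔ (below n n n k) (cr n k)
        (λ α ((mem , cyc) , av) → mem ,
          ((λ i → av fixed i (Fin.toℕ<n i)) , λ i e → av dual i (Fin.toℕ<n i)
            (sym (trans (sym (Perm.inverseʳ α)) (cong (α ⟨$⟩ʳ_) e)))) , cyc)
        (λ α (mem , (¬f , ¬d) , cyc) → (mem , cyc) , λ
          { fixed i _ e → ¬f i e
          ; dual  i _ e → ¬d i (trans (cong (α Perm.⟨$⟩ˡ_) (sym e)) (Perm.inverseˡ α)) })

      module _ {u n} (u<2+n : u < suc (suc n)) where
        private
          i = Fin.fromℕ< u<2+n
          toℕ-i : toℕ i ≡ u
          toℕ-i = Fin.toℕ-fromℕ< u<2+n

        private
          branching-fixed : Branching fixed i (Below u u) (Below (suc u) u) (Below u (pred u))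
          branching-fixed = subst (λ u → Branching fixed i (Below u u) (Below (suc u) u) (Below u (pred u)))
            toℕ-i (branch-fixed i)

        #below-fixed : ∀ k → #below u u (suc (suc n)) (suc k) ≡
                       #below (suc u) u (suc (suc n)) (suc k) + #below u (pred u) (suc n) k
        #below-fixed k = recurrence branching-fixed (below u u _ (suc k)) (below (suc u) u _ (suc k)) (below u (pred u) _ k)

        #below-fixed₀ : #below u u (suc (suc n)) 0 ≡ #below (suc u) u (suc (suc n)) 0
        #below-fixed₀ = recurrence₀ branching-fixed refl (below u u _ 0) (below (suc u) u _ 0)

        #below-dual : u < suc n → ∀ k → #below (suc u) u (suc (suc n)) k ≡
                      #below (suc u) (suc u) (suc (suc n)) k + #below u u (suc n) k
        #below-dual u<1+n k = recurrence
          (subst (λ u → u < suc n → Branching dual i (Below (suc u) u) (Below (suc u) (suc u)) (Below u u))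
            toℕ-i (branch-dual i) u<1+n)
          (below (suc u) u _ k) (below (suc u) (suc u) _ k) (below u u _ k)

      #below-last : ∀ n k → #below (suc (suc n)) (suc n) (suc (suc n)) k ≡ r (suc (suc n)) k + #butFirst (suc n) k
      #below-last n k = trans
        (recurrence (branch-dual-last (Fin.fromℕ (suc n)) (Fin.toℕ-fromℕ (suc n)))
          (below (suc (suc n)) (suc n) _ k) (below (suc (suc n)) (suc (suc n)) _ k) (butFirst _ k))
        (cong (_+ #butFirst (suc n) k) (#reduced (suc (suc n)) k))

      #butFirst-rec : ∀ n k → #butFirst (suc (suc n)) (suc k) ≡ r (suc (suc n)) (suc k) + #below (suc n) n (suc n) k
      #butFirst-rec n k = trans
        (recurrence branch-fixed-first (butFirst _ (suc k)) (below (suc (suc n)) (suc (suc n)) _ (suc k)) (below (suc n) n _ k))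
        (cong (_+ #below (suc n) n (suc n) k) (#reduced (suc (suc n)) (suc k)))

      #butFirst-rec₀ : ∀ n → #butFirst (suc (suc n)) 0 ≡ r (suc (suc n)) 0
      #butFirst-rec₀ n = trans
        (recurrence₀ branch-fixed-first refl (butFirst _ 0) (below (suc (suc n)) (suc (suc n)) _ 0))
        (#reduced (suc (suc n)) 0)

-- Identification with the series of the theorem

module Assembly where

  open import Defs as Defs
    using (Series; fromℕℚ; _≋_; generatingFunction; PermutationClass; ClosedUnderReductions;
           ClosedUnderExtensions; ExcludesEmpty; CountsAll; CountsReduced)
  open Combinatorics using (_C_)
  open ≡
  open Binomials
  open Counting using (module Class)

  module ℚ[[y]] = PowerSeries ℚ.+-*-commutativeRing

  -- Power series in x over this ring have the carrier `Series` on the nose: the first index is the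
  -- exponent of x, the second that of y.
  Ry : CommutativeRing _ _
  Ry = ℚ[[y]].ring

  y : ℕ → ℚ
  y = ℚ[[y]].x

  private
    module Ry = CommutativeRing Ry
    _*ʸ_ = ℚ[[y]]._⊛_

  open PowerSeries Ry
  open LagrangeInversion Ry y
  open Substitution Ry y

  private
    module K = CommutativeRing ring

  -- The coefficient of yᵃ in that of wⁿ⁻ᵐ in (1 + w)ⁿ(1 + yw)ⁿ: the second factor gives C(n,a), and
  -- the first C(n,n-m-a) = C(n,m+a).
  β : ℕ → ℕ → ℕ → ℚ
  β m n a = ι ((n C a) ℕ.* (n C (m ℕ.+ a)))

  private
    y-zero : ∀ A → (y *ʸ A) 0 ≡ 0ℚ
    y-zero = ℚ[[y]].x-zero

    y-suc : ∀ A k → (y *ʸ A) (suc k) ≡ A k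
    y-suc = ℚ[[y]].x-suc

    y-zero-ι : ∀ A → (y *ʸ A) 0 ≡ ι 0
    y-zero-ι A = trans (y-zero A) (sym ι-zero)

    ι-+₄ : ∀ {n} a b c d → n ≡ a ℕ.+ (b ℕ.+ c) ℕ.+ d → ι n ≡ ι a ℚ.+ (ι b ℚ.+ ι c) ℚ.+ ι d
    ι-+₄ a b c d refl = trans (ι-+ (a ℕ.+ (b ℕ.+ c)) d) (cong (ℚ._+ ι d)
      (trans (ι-+ a (b ℕ.+ c)) (cong (ι a ℚ.+_) (ι-+ b c))))

    ι-+₄′ : ∀ {n} a b c d → n ≡ a ℕ.+ b ℕ.+ (c ℕ.+ d) → ι n ≡ ι a ℚ.+ ι b ℚ.+ (ι c ℚ.+ ι d)
    ι-+₄′ a b c d refl = trans (ι-+ (a ℕ.+ b) (c ℕ.+ d)) (cong₂ ℚ._+_ (ι-+ a b) (ι-+ c d))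

  β-step₀ : ∀ n a → β 0 (suc n) a ≡
            β 0 n a ℚ.+ (y *ʸ β 0 n) a ℚ.+ ((y *ʸ β 1 n) a ℚ.+ (y *ʸ β 1 n) a)
  β-step₀ n zero = trans (ι-+₄′ 1 0 0 0 refl)
    (sym (cong₂ ℚ._+_ (cong (ι 1 ℚ.+_) (y-zero-ι (β 0 n))) (cong₂ ℚ._+_ (y-zero-ι (β 1 n)) (y-zero-ι (β 1 n)))))
  β-step₀ n (suc b) = trans
    (ι-+₄′ (c₁ ℕ.* c₁) (c₀ ℕ.* c₀) (c₀ ℕ.* c₁) (c₀ ℕ.* c₁)
      (trans (cong₂ ℕ._*_ (pascal n b) (pascal n b)) (expand c₀ c₁)))
    (sym (cong₂ ℚ._+_ (cong (ι (c₁ ℕ.* c₁) ℚ.+_) (y-suc (β 0 n) b)) (cong₂ ℚ._+_ (y-suc (β 1 n) b) (y-suc (β 1 n) b))))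
    where
    c₀ = n C b
    c₁ = n C suc b
    expand : ∀ c₀ c₁ → (c₀ ℕ.+ c₁) ℕ.* (c₀ ℕ.+ c₁) ≡ c₁ ℕ.* c₁ ℕ.+ c₀ ℕ.* c₀ ℕ.+ (c₀ ℕ.* c₁ ℕ.+ c₀ ℕ.* c₁)
    expand = solve-∀

  β-stepₘ : ∀ m n a → β (suc m) (suc n) a ≡
            β m n a ℚ.+ (β (suc m) n a ℚ.+ (y *ʸ β (suc m) n) a) ℚ.+ (y *ʸ β (suc (suc m)) n) a
  β-stepₘ m n zero = trans
    (ι-+₄ (1 ℕ.* d₀) (1 ℕ.* d₁) 0 0 (trans (cong (1 ℕ.*_) (pascal n (m ℕ.+ 0))) (expand d₀ d₁)))
    (sym (cong₂ ℚ._+_ (cong (λ u → ι (1 ℕ.* d₀) ℚ.+ (ι (1 ℕ.* d₁) ℚ.+ u)) (y-zero-ι (β (suc m) n)))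
      (y-zero-ι (β (suc (suc m)) n))))
    where
    d₀ = n C (m ℕ.+ 0)
    d₁ = n C suc (m ℕ.+ 0)
    expand : ∀ d₀ d₁ → 1 ℕ.* (d₀ ℕ.+ d₁) ≡ 1 ℕ.* d₀ ℕ.+ (1 ℕ.* d₁ ℕ.+ 0) ℕ.+ 0
    expand = solve-∀
  β-stepₘ m n (suc b) = trans
    (ι-+₄ (c₁ ℕ.* (n C (m ℕ.+ suc b))) (c₁ ℕ.* (n C suc (m ℕ.+ suc b))) (c₀ ℕ.* (n C suc (m ℕ.+ b))) (c₀ ℕ.* (n C suc (suc (m ℕ.+ b))))
      (trans (cong₂ ℕ._*_ (pascal n b) (pascal n (m ℕ.+ suc b)))
        (subst (λ l → (c₀ ℕ.+ c₁) ℕ.* ((n C l) ℕ.+ (n C suc l)) ≡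
            c₁ ℕ.* (n C l) ℕ.+ (c₁ ℕ.* (n C suc l) ℕ.+ c₀ ℕ.* (n C suc (m ℕ.+ b))) ℕ.+ c₀ ℕ.* (n C suc (suc (m ℕ.+ b))))
          (sym (ℕ.+-suc m b)) (expand c₀ c₁ (n C suc (m ℕ.+ b)) (n C suc (suc (m ℕ.+ b)))))))
    (sym (cong₂ ℚ._+_ (cong (λ u → β m n (suc b) ℚ.+ (β (suc m) n (suc b) ℚ.+ u)) (y-suc (β (suc m) n) b))
      (y-suc (β (suc (suc m)) n) b)))
    where
    c₀ = n C b
    c₁ = n C suc b
    expand : ∀ c₀ c₁ d₁ d₂ → (c₀ ℕ.+ c₁) ℕ.* (d₁ ℕ.+ d₂) ≡
             c₁ ℕ.* d₁ ℕ.+ (c₁ ℕ.* d₂ ℕ.+ c₀ ℕ.* d₁) ℕ.+ c₀ ℕ.* d₂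
    expand = solve-∀

  β-lagrangian : Lagrangian β
  β-lagrangian = record
    { V₀₀   = λ { zero → ι-one ; (suc a) → ι-zero }
    ; Vₘ₀   = λ m a → trans (cong ι (ℕ.*-zeroʳ (0 C a))) ι-zero
    ; step₀ = β-step₀
    ; stepₘ = β-stepₘ
    }

  sum-at : ∀ {n} (f : Fin n → ℕ → ℚ) k →
           Sum.sum Ry.+-commutativeMonoid f k ≡ Sum.sum ℚ.+-0-commutativeMonoid (λ i → f i k)
  sum-at {zero}  f k = refl
  sum-at {suc n} f k = cong (f Fin.zero k ℚ.+_) (sum-at (λ i → f (Fin.suc i)) k)

  *-⊛ : ∀ A B → A Defs.* B ≋ A ⊛ B
  *-⊛ A B n k = sym (trans (⊛-sum A B n k) (trans (sum-at {suc n} (λ i → A (toℕ i) *ʸ B (n ∸ toℕ i)) k)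
    (Sum.sum-cong-≋ ℚ.+-0-commutativeMonoid {suc n} (λ i → ℚ[[y]].⊛-sum (A (toℕ i)) (B (n ∸ toℕ i)) k))))

  𝟙≋1# : Defs.𝟙 ≋ K.1#
  𝟙≋1# zero    zero    = refl
  𝟙≋1# zero    (suc k) = refl
  𝟙≋1# (suc n) zero    = refl
  𝟙≋1# (suc n) (suc k) = refl

  X≋x : Defs.X ≋ x
  X≋x zero          zero    = refl
  X≋x zero          (suc k) = refl
  X≋x (suc zero)    zero    = refl
  X≋x (suc zero)    (suc k) = refl
  X≋x (suc (suc n)) zero    = refl
  X≋x (suc (suc n)) (suc k) = refl

  Y≋Y : Defs.Y ≋ Y
  Y≋Y zero    zero          = refl
  Y≋Y zero    (suc zero)    = refl
  Y≋Y zero    (suc (suc k)) = refl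
  Y≋Y (suc n) k             = refl

  4≋1+1+1+1 : Defs.const (fromℕℚ 4) ≋ K.1# ⊕ K.1# ⊕ K.1# ⊕ K.1#
  4≋1+1+1+1 zero    zero    = refl
  4≋1+1+1+1 zero    (suc k) = refl
  4≋1+1+1+1 (suc n) zero    = refl
  4≋1+1+1+1 (suc n) (suc k) = refl

  ^-^ : ∀ {A B} → A ≋ B → ∀ m → A Defs.^ m ≋ B ^ m
  ^-^ A≋B zero    = 𝟙≋1#
  ^-^ {A} {B} A≋B (suc m) = K.trans (*-⊛ A (A Defs.^ m)) (⊛-cong {A = A} {B} {A Defs.^ m} A≋B (^-^ A≋B m))

  private
    e s : Series
    e = x ⊕ x ⊛ Y ⊕ (x ⊛ Y ⊛ W ⊕ x ⊛ Y ⊛ W)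
    s = K._-_ K.1# e

    s-eqn : s ⊕ e ≐ K.1#
    s-eqn = QuadraticIdentities.[a-b]+b ring K.1# e

    module _ {S : Series} (S-root : Defs.IsSquareRoot S Defs.discriminant) where

      b-1 : Series
      b-1 = K._-_ (x ⊕ x ⊛ Y) K.1#

      X+XY-1 : Defs.X Defs.+ Defs.X Defs.* Defs.Y Defs.- Defs.𝟙 ≋ b-1
      X+XY-1 n k = cong₂ ℚ._-_ (cong₂ ℚ._+_ (X≋x n k)
        (trans (*-⊛ Defs.X Defs.Y n k) (⊛-cong {Defs.X} {x} {Defs.Y} X≋x Y≋Y n k))) (𝟙≋1# n k)

      4x²y : Series
      4x²y = x ⊛ x ⊛ Y ⊕ x ⊛ x ⊛ Y ⊕ x ⊛ x ⊛ Y ⊕ x ⊛ x ⊛ Y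

      4X²Y : Defs.const (fromℕℚ 4) Defs.* Defs.X Defs.^ 2 Defs.* Defs.Y ≋ 4x²y
      4X²Y = K.trans (*-⊛ (Defs.const (fromℕℚ 4) Defs.* Defs.X Defs.^ 2) Defs.Y)
        (K.trans (⊛-cong {B = Defs.Y}
          (K.trans (*-⊛ (Defs.const (fromℕℚ 4)) (Defs.X Defs.^ 2))
            (⊛-cong {B = Defs.X Defs.^ 2} 4≋1+1+1+1 (^-^ X≋x 2))) Y≋Y)
          (QuadraticIdentities.four*x²*y ring x Y))

      S²-eqn : S ⊛ S ⊕ 4x²y ≐ b-1 ⊛ b-1
      S²-eqn = K.trans (λ n k → cong₂ ℚ._+_
          (trans (sym (*-⊛ S S n k)) (trans (proj₂ S-root n k)
            (cong₂ ℚ._-_ (K.trans (^-^ X+XY-1 2) (⊛-cong {b-1} {B = b-1 ⊛ K.1#} K.refl (K.*-identityʳ b-1)) n k) (4X²Y n k)))) refl)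
        (QuadraticIdentities.[a-b]+b ring (b-1 ⊛ b-1) 4x²y)

      S²≈s² : S ⊛ S ≐ s ⊛ s
      S²≈s² = RingProperties.+-cancelʳ K.ring 4x²y (S ⊛ S) (s ⊛ s)
        (K.trans S²-eqn (K.sym (QuadraticIdentities.s²-eqn ring x Y W s W-eqn s-eqn)))

      e₀₀ : e 0 0 ≡ 0ℚ
      e₀₀ = cong₂ ℚ._+_ (cong (0ℚ ℚ.+_) (x-zero Y 0)) (cong₂ ℚ._+_ xYW₀₀ xYW₀₀)
        where
        xYW₀₀ : (x ⊛ Y ⊛ W) 0 0 ≡ 0ℚ
        xYW₀₀ = trans (K.*-assoc x Y W 0 0) (x-zero (Y ⊛ W) 0)

      -- Both have the same square, so (S - s)(S + s) = 0, and S + s has constant term 2. Regularity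
      -- is passed on from ℚ to series in y and from there to series in x.
      S≈s : S ≐ s
      S≈s = RingProperties.x∙y⁻¹≈ε⇒x≈y K.ring S s
        (regular (S ⊕ s)
          (λ a a*≈0 → ℚ[[y]].regular ((S ⊕ s) 0)
            (λ q q*≡0 → trans (sym (ℚ.*-identityʳ q)) (trans (sym (ℚ.*-assoc q (fromℕℚ 2) ℚ.½))
              (cong (ℚ._* ℚ.½) (trans (cong (q ℚ.*_) (sym two)) q*≡0)))) a a*≈0)
          (K._-_ S s) (QuadraticIdentities.difference-of-squares ring S s S²≈s²))
        where
        two : (S ⊕ s) 0 0 ≡ fromℕℚ 2
        two = cong₂ ℚ._+_ (proj₁ S-root) (cong (λ q → 1ℚ ℚ.- q) e₀₀)

  private
    module _ {T : Series} (t-eqn : T ⊛ s ≐ K.1#) where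
      private
        module G = ViaW W s T W-eqn s-eqn t-eqn

      G≈β : ∀ m n → G.G m n Ry.≈ β m n
      G≈β = Lagrangian-unique G.lagrangian β-lagrangian

      ℚ-+-cancelʳ : ∀ {p q} r → p ℚ.+ r ≡ q ℚ.+ r → p ≡ q
      ℚ-+-cancelʳ {p} {q} r = RingProperties.+-cancelʳ ℚ.+-*-ring r p q

      -- Comes from `w-from-t`: the coefficients of W are differences of products of binomials, to
      -- be matched with `narayana`.
      W-narayana : ∀ n a → W (suc n) a ℚ.+ (y *ʸ β 2 n) a ≡ β 0 n a
      W-narayana n a = trans (cong (W (suc n) a ℚ.+_) (sym (Ry.*-congˡ {y} (G≈β 2 n) a)))
        (trans (G.wₛ-eqn n a) (G≈β 0 n a))

      divide : ∀ n {u v w} → suc n ℕ.* u ≡ v ℕ.+ suc n ℕ.* w → ι u ≡ (ℤ.+ 1 ℚ./ suc n) ℚ.* ι v ℚ.+ ι w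
      divide n {u} {v} {w} eq = go (ℤ.+ 1 ℚ./ suc n) (1/n*n n)
        where
        open ≡-Reasoning
        N = ι (suc n)
        go : ∀ i → i ℚ.* N ≡ 1ℚ → ι u ≡ i ℚ.* ι v ℚ.+ ι w
        go i iN≡1 = begin
          ι u                                ≡⟨ ℚ.*-identityˡ _ ⟨
          1ℚ ℚ.* ι u                         ≡⟨ cong (ℚ._* ι u) iN≡1 ⟨
          i ℚ.* N ℚ.* ι u                    ≡⟨ ℚ.*-assoc i N _ ⟩
          i ℚ.* (N ℚ.* ι u)                  ≡⟨ cong (i ℚ.*_) (trans (sym (ι-* (suc n) u)) (trans (cong ι eq)
              (trans (ι-+ v (suc n ℕ.* w)) (cong (ι v ℚ.+_) (ι-* (suc n) w))))) ⟩
          i ℚ.* (ι v ℚ.+ N ℚ.* ι w)          ≡⟨ ℚ.*-distribˡ-+ i _ _ ⟩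
          i ℚ.* ι v ℚ.+ i ℚ.* (N ℚ.* ι w)
            ≡⟨ cong (i ℚ.* ι v ℚ.+_) (trans (sym (ℚ.*-assoc i N _))
                 (trans (cong (ℚ._* ι w) iN≡1) (ℚ.*-identityˡ _))) ⟩
          i ℚ.* ι v ℚ.+ ι w                  ∎

      D-coefficient : ∀ n a → (ℤ.+ 1 ℚ./ suc n) ℚ.* ι ((suc n C suc a) ℕ.* (suc n C a)) ≡
                      Defs.divY (Defs.D Defs.- Defs.𝟙) (suc n) a
      D-coefficient n a = go (ℤ.+ 1 ℚ./ suc n) (fromℕℚ≡ι (suc n C suc a)) (fromℕℚ≡ι (suc n C a))
        where
        -- The fractions become variables, so that no gcd is computed on open terms.
        go : ∀ i {u v} → u ≡ ι (suc n C suc a) → v ≡ ι (suc n C a) →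
             i ℚ.* ι ((suc n C suc a) ℕ.* (suc n C a)) ≡ i ℚ.* u ℚ.* v ℚ.- 0ℚ
        go i refl refl = trans (cong (i ℚ.*_) (ι-* (suc n C suc a) (suc n C a)))
          (trans (sym (ℚ.*-assoc i _ _)) (sym (ℚ.+-identityʳ _)))

      W≋ : W ≋ Defs.divY (Defs.D Defs.- Defs.𝟙)
      W≋ zero    a       = G.w₀≈0 a
      W≋ (suc n) zero    = trans (sym (ℚ.+-identityʳ _)) (trans (cong (W (suc n) 0 ℚ.+_) (sym (y-zero (β 2 n))))
        (trans (W-narayana n 0) (trans (divide n {1} {(suc n C 1) ℕ.* 1} {0}
          (trans (sym (absorption n 0)) (expand (suc n C 1) n)))
          (trans (cong ((ℤ.+ 1 ℚ./ suc n) ℚ.* ι ((suc n C 1) ℕ.* 1) ℚ.+_) ι-zero) (trans (ℚ.+-identityʳ _) (D-coefficient n 0))))))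
        where
        expand : ∀ c n → 1 ℕ.* c ≡ c ℕ.* 1 ℕ.+ suc n ℕ.* 0
        expand = solve-∀
      W≋ (suc n) (suc b) = ℚ-+-cancelʳ (β 2 n b) (trans (cong (W (suc n) (suc b) ℚ.+_) (sym (y-suc (β 2 n) b)))
        (trans (W-narayana n (suc b)) (trans (divide n (narayana n b))
          (cong (ℚ._+ β 2 n b) (D-coefficient n (suc b))))))

      substX-substitute : ∀ R → Defs.substX R (Defs.divY (Defs.D Defs.- Defs.𝟙)) ≋ substitute R
      substX-substitute R n k = sym (trans (sum-at {suc n} (λ m → R (toℕ m) *ʸ (W ^ toℕ m) n) k)
        (Sum.sum-cong-≋ ℚ.+-0-commutativeMonoid {suc n} (λ m → trans
          (Ry.*-congˡ {R (toℕ m)} (K.sym (^-^ (K.sym W≋) (toℕ m)) n) k)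
          (ℚ[[y]].⊛-sum (R (toℕ m)) _ k))))

      substX-* : ∀ R n → (Defs.substX R (Defs.divY (Defs.D Defs.- Defs.𝟙)) Defs.* T) n Ry.≈
                 Sum.sum Ry.+-commutativeMonoid {suc n} (λ m → R (toℕ m) *ʸ β (toℕ m) n)
      substX-* R n = Ry.trans (*-⊛ (Defs.substX R (Defs.divY (Defs.D Defs.- Defs.𝟙))) T n)
        (Ry.trans (⊛-cong {B = T} (substX-substitute R) K.refl n)
        (Ry.trans (substitute-⊛ R T n)
          (Sum.sum-cong-≋ Ry.+-commutativeMonoid {suc n} (λ m → Ry.*-congˡ {R (toℕ m)} (G≈β (toℕ m) n)))))

  substX-formula : ∀ {S T} → Defs.IsSquareRoot S Defs.discriminant → Defs.IsReciprocal T S → ∀ R n →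
    (Defs.substX R (Defs.divY (Defs.D Defs.- Defs.𝟙)) Defs.* T) n Ry.≈
    Sum.sum Ry.+-commutativeMonoid {suc n} (λ m → R (toℕ m) *ʸ Φ (toℕ m) n)
  substX-formula {S} {T} S-root T-reciprocal R n = Ry.trans (substX-* t-eqn R n)
    (Sum.sum-cong-≋ Ry.+-commutativeMonoid {suc n} (λ m →
      Ry.*-congˡ {R (toℕ m)} (Lagrangian-unique β-lagrangian Φ-lagrangian (toℕ m) n)))
    where
    t-eqn : T ⊛ s ≐ K.1#
    t-eqn = K.trans (⊛-cong {T} {B = s} K.refl (K.sym (S≈s S-root)))
      (K.trans (K.sym (*-⊛ T S)) (K.trans T-reciprocal 𝟙≋1#))

  -- The enumerating polynomials of a closed class

  module _ {ℓ} (𝒞 : PermutationClass ℓ) (red : ClosedUnderReductions 𝒞)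
    (ext : ClosedUnderExtensions 𝒞) (excl : ExcludesEmpty 𝒞)
    {p r : ℕ → ℕ → ℕ} (cp : CountsAll 𝒞 p) (cr : CountsReduced 𝒞 r) where

    private
      open Class 𝒞 red ext excl
      open Recurrences cp cr

      ⟦_⟧ : (ℕ → ℕ) → ℕ → ℚ
      ⟦ a ⟧ k = ι (a k)

      E F : ℕ → ℕ → ℕ → ℚ
      E u d = ⟦ #below u u (u ℕ.+ d) ⟧
      F u d = ⟦ #below (suc u) u (suc (u ℕ.+ d)) ⟧

      ⟦⟧-+ : ∀ {a b c} → (∀ k → a k ≡ b k ℕ.+ c k) → ⟦ a ⟧ Ry.≈ ⟦ b ⟧ Ry.+ ⟦ c ⟧
      ⟦⟧-+ eq k = trans (cong ι (eq k)) (ι-+ _ _)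

      -- A deleted fixed point takes one cycle along, which is a factor y. The two premises are the
      -- forms of `recurrence₀` and `recurrence`.
      ⟦⟧-+y : ∀ {a b c} → a 0 ≡ b 0 → (∀ k → a (suc k) ≡ b (suc k) ℕ.+ c k) →
              ⟦ a ⟧ Ry.≈ ⟦ b ⟧ Ry.+ y *ʸ ⟦ c ⟧
      ⟦⟧-+y {b = b} {c} eq₀ eqₛ zero    = trans (cong ι eq₀)
        (sym (trans (cong (ι (b 0) ℚ.+_) (y-zero ⟦ c ⟧)) (ℚ.+-identityʳ (ι (b 0)))))
      ⟦⟧-+y {b = b} {c} eq₀ eqₛ (suc k) = trans (cong ι (eqₛ k))
        (trans (ι-+ (b (suc k)) (c k)) (cong (ι (b (suc k)) ℚ.+_) (sym (y-suc ⟦ c ⟧ k))))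

      none : ∀ {a} → (∀ k → a k ≡ 0) → ⟦ a ⟧ Ry.≈ Ry.0#
      none a≡0 k = trans (cong ι (a≡0 k)) ι-zero

      E-zero : ∀ d → E 0 (suc d) Ry.≈ F 0 d Ry.+ y *ʸ E 0 d
      -- The branching starts at size 2; here the sizes are 0 and 1, where all counts vanish.
      E-zero zero    = Ry.trans (none (proj₂ ∘ #below-none)) (Ry.sym (Ry.trans
        (Ry.+-cong (none (proj₂ ∘ #below-none {1} {0})) (Ry.trans (Ry.*-congˡ {y} (none (proj₁ ∘ #below-none))) (Ry.zeroʳ y)))
        (Ry.+-identityʳ Ry.0#)))
      E-zero (suc d) = ⟦⟧-+y (#below-fixed₀ (s≤s z≤n)) (#below-fixed (s≤s z≤n))

      E-suc : ∀ u d → E (suc u) (suc d) Ry.≈ F (suc u) d Ry.+ y *ʸ F u d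
      E-suc u d = Ry.trans
        (Ry.reflexive (cong (λ n → ⟦ #below (suc u) (suc u) (suc n) ⟧) (ℕ.+-suc u d)))
        (⟦⟧-+y (#below-fixed₀ u<) (#below-fixed u<))
        where
        u< : suc u < suc (suc (u ℕ.+ d))
        u< = s≤s (s≤s (ℕ.m≤m+n u d))

      F-suc : ∀ u d → F u (suc d) Ry.≈ E (suc u) (suc d) Ry.+ E u (suc d)
      F-suc u d = subst
        (λ n → ⟦ #below (suc u) u (suc n) ⟧ Ry.≈ ⟦ #below (suc u) (suc u) (suc n) ⟧ Ry.+ ⟦ #below u u n ⟧)
        (sym (ℕ.+-suc u d))
        (⟦⟧-+ (#below-dual (s≤s (ℕ.m≤n⇒m≤1+n (ℕ.m≤m+n u d))) (s≤s (ℕ.m≤m+n u d))))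

      F₁₀ : F 1 0 Ry.≈ ⟦ r 2 ⟧
      F₁₀ k = cong ι (trans (#below-last 0 k)
        (trans (cong (r 2 k ℕ.+_) (#butFirst₁ k)) (ℕ.+-identityʳ (r 2 k))))

      -- One passage around the seam: first the last dual condition is added, then the first fixed
      -- one in the size below, and only the latter contributes a factor y.
      F-last : ∀ u → F (suc (suc u)) 0 Ry.≈
               ⟦ r (suc (suc (suc u))) ⟧ Ry.+ (⟦ r (suc (suc u)) ⟧ Ry.+ y *ʸ F u 0)
      F-last u rewrite ℕ.+-identityʳ u = Ry.trans (⟦⟧-+ (#below-last (suc u)))
        (Ry.+-congˡ {⟦ r (suc (suc (suc u))) ⟧} (⟦⟧-+y (#butFirst-rec₀ u) (#butFirst-rec u)))

    count-formula : ∀ n → generatingFunction p n Ry.≈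
      Sum.sum Ry.+-commutativeMonoid {suc n} (λ m → generatingFunction r (toℕ m) *ʸ Φ (toℕ m) n)
    count-formula n = Ry.trans (λ k → trans (fromℕℚ≡ι (p n k)) (cong ι (#all n k)))
      (Ry.trans
        (AvoidanceRecurrences.E-formula Ry y E F (λ n → ⟦ r n ⟧)
          (none (proj₁ ∘ #reduced-none)) (none (proj₂ ∘ #reduced-none)) (none (proj₁ ∘ #below-none))
          E-zero E-suc F-suc (none (proj₂ ∘ #below-none)) F₁₀ F-last n)
        (Sum.sum-cong-≋ Ry.+-commutativeMonoid {suc n} (λ m →
          Ry.*-congʳ {Φ (toℕ m) n} (λ k → sym (fromℕℚ≡ι (r (toℕ m) k))))))

open import Defs
open import Data.Nat.Base using (ℕ)

theorem4p2 : ∀ {ℓ} (𝒞 : PermutationClass ℓ) →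
    ClosedUnderReductions 𝒞 →
    ClosedUnderExtensions 𝒞 →
    ExcludesEmpty 𝒞 →
    (p r : ℕ → ℕ → ℕ) →
    CountsAll 𝒞 p →
    CountsReduced 𝒞 r →
    (S T : Series) →
    IsSquareRoot S discriminant →
    IsReciprocal T S →
    generatingFunction p ≋ substX (generatingFunction r) (divY (D - 𝟙)) * T
theorem4p2 𝒞 red ext excl p r cp cr S T S-root T-reciprocal n =
  trans (Assembly.count-formula 𝒞 red ext excl cp cr n)
        (sym (Assembly.substX-formula {S} {T} S-root T-reciprocal (generatingFunction r) n))
  where open CommutativeRing Assembly.Ry using (trans; sym)
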